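{- For every $w\in\mathcal{A}^1_{\mathbb{C}^\times}$ there is $\varepsilon>0$ such that $\mathrm{Li}^{\mathrm{sh}}_w(z)=\mathrm{Li}^{\mathrm{sh}}_{\varphi\iota(w)}\!\left(\frac{z}{z-1}\right)$ for all complex $z$ with $|z|<\varepsilon$.
   Context: $\mathcal{A}_{\mathbb{C}^\times}=\mathbb{Q}\langle x,y_s\mid s\in\mathbb{C}^\times\rangle$, $\mathcal{A}^1_{\mathbb{C}^\times}=\mathbb{Q}+\sum_s\mathcal{A}_{\mathbb{C}^\times}y_s$. For $k_i\ge1$, $s_i\in\mathbb{C}^\times$, $\mathrm{Li}^{\mathrm{sh}}_{x^{k_1-1}y_{s_1}\cdots x^{k_n-1}y_{s_n}}(z)=\sum_{m_1>\cdots>m_n>0}\frac{s_1^{m_1-m_2}\cdots s_{n-1}^{m_{n-1}-m_n}s_n^{m_n}}{m_1^{k_1}\cdots m_n^{k_n}}z^{m_1}$ (convergent near $z=0$), $\mathrm{Li}^{\mathrm{sh}}_1=1$, extended $\mathbb{Q}$-linearly. $\delta(s)=0$ if $s\in\{0,1\}$, $1$ otherwise. $\varphi$, $\iota$ are the algebra automorphisms with $\varphi(x)=x+y_1$, $\varphi(y_s)=\delta(s)y_s-y_1$, $\iota(x)=x$, $\iota(y_s)=\delta(s)y_{1-s}-(1-\delta(s))y_1$.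
   Formalization: The sign in ι is corrected to ι(y_s)=δ(s)y_{1-s}+(1-δ(s))y_1, so ι(y_1)=+y_1; with the printed minus sign φι(y_1)=y_1, and w=y_1 would give −log(1−z)=log(1−z), which is false. -}

module Defs where

open import Algebra.Bundles using (CommutativeRing; RawRing; Semiring)
import Algebra.Definitions.RawSemiring as RawSemiringDefinitions
import Algebra.Properties.Group as GroupProperties
open import Data.Bool.Base using (if_then_else_)
open import Data.Fin.Base using (toℕ)
open import Data.Integer.Base using (ℤ; +_; -[1+_])
open import Data.List.Base
  using (List; []; _∷_; _++_; _∷ʳ_; map; concatMap; cartesianProductWith; foldr)
open import Data.List.Properties using (++-assoc)
open import Data.List.Relation.Unary.All using (All; []; _∷_)
import Data.List.Relation.Unary.All as All
import Data.List.Relation.Unary.All.Properties as All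
open import Data.Nat.Base as ℕ using (ℕ; suc; _∸_)
open import Data.Product using (_×_; _,_; ∃-syntax; Σ-syntax; proj₁; proj₂)
open import Data.Rational.Base as ℚ using (ℚ; 0ℚ; 1ℚ; ↥_; ↧ₙ_)
open import Data.Sum.Base using (_⊎_; inj₁; inj₂)
open import Level using (_⊔_) renaming (suc to lsuc)
open import Relation.Binary.Core using (Rel)
open import Relation.Binary.PropositionalEquality using (_≡_; refl; sym)
open import Relation.Binary.Structures using (IsStrictTotalOrder)
open import Relation.Nullary.Decidable using (Dec; yes; no; ⌊_⌋; _×-dec_; _⊎-dec_)
open import Relation.Nullary.Negation using (¬_)

-- The real numbers, characterised up to isomorphism as the Archimedean ordered
-- field in which every Cauchy sequence converges (classically equivalent to the
-- least-upper-bound property).  Trichotomy is part of the structure, as for the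
-- classical reals.

record CompleteOrderedField c ℓ₁ ℓ₂ : Set (lsuc (c ⊔ ℓ₁ ⊔ ℓ₂)) where
  field
    commutativeRing : CommutativeRing c ℓ₁

  open CommutativeRing commutativeRing public
  open RawSemiringDefinitions (Semiring.rawSemiring semiring) public
    using (_^_) renaming (_×_ to _×ₙ_)

  infix 4 _<_

  field
    _<_                : Rel Carrier ℓ₂
    isStrictTotalOrder : IsStrictTotalOrder _≈_ _<_
    0<1                : 0# < 1#
    +-monoˡ-<          : ∀ z {x y} → x < y → x + z < y + z
    *-pos              : ∀ {x y} → 0# < x → 0# < y → 0# < x * y
    inverse            : ∀ x → ¬ (x ≈ 0#) → ∃[ y ] x * y ≈ 1#
    archimedean        : ∀ x → ∃[ n ] x < n ×ₙ 1#

  open IsStrictTotalOrder isStrictTotalOrder public using (compare; _≟_; _<?_)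

  -- The condition for both (m , n) and (n , m) bounds the absolute value.
  IsCauchy : (ℕ → Carrier) → Set (c ⊔ ℓ₂)
  IsCauchy u = ∀ ε → 0# < ε →
    ∃[ N ] (∀ m n → N ℕ.≤ m → N ℕ.≤ n → u m - u n < ε)

  IsLimit : (ℕ → Carrier) → Carrier → Set (c ⊔ ℓ₂)
  IsLimit u l = ∀ ε → 0# < ε →
    ∃[ N ] (∀ n → N ℕ.≤ n → (- ε < u n - l) × (u n - l < ε))

  field
    complete : ∀ u → IsCauchy u → ∃[ l ] IsLimit u l

  -- Totalised by 0⁻¹ = 0.
  infix 8 _⁻¹
  _⁻¹ : Carrier → Carrier
  x ⁻¹ with x ≟ 0#
  ... | yes _  = 0#
  ... | no x≉0 = proj₁ (inverse x x≉0)

  fromℤ : ℤ → Carrier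
  fromℤ (+ n)    = n ×ₙ 1#
  fromℤ -[1+ n ] = - (suc n ×ₙ 1#)

  fromℚ : ℚ → Carrier
  fromℚ q = fromℤ (↥ q) * (↧ₙ q ×ₙ 1#) ⁻¹

module ComplexNumbers {c ℓ₁ ℓ₂} (ℝ : CompleteOrderedField c ℓ₁ ℓ₂) where

  private module R = CompleteOrderedField ℝ

  infix 5 _+i_
  record ℂ : Set c where
    constructor _+i_
    field
      re im : R.Carrier

  open ℂ public

  ℂ-rawRing : RawRing c ℓ₁
  ℂ-rawRing = record
    { Carrier = ℂ
    ; _≈_     = λ z w → (re z R.≈ re w) × (im z R.≈ im w)
    ; _+_     = λ z w → (re z R.+ re w) +i (im z R.+ im w)
    ; _*_     = λ z w → (re z R.* re w R.- im z R.* im w)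
                     +i (re z R.* im w R.+ im z R.* re w)
    ; -_      = λ z → (R.- re z) +i (R.- im z)
    ; 0#      = R.0# +i R.0#
    ; 1#      = R.1# +i R.0#
    }

  open RawRing ℂ-rawRing public
    using (_≈_; _+_; _*_; -_; 0#; 1#; rawSemiring)
  open RawSemiringDefinitions rawSemiring public
    using (_^_; sum) renaming (_×_ to _×ₙ_)

  infixl 6 _-_
  _-_ : ℂ → ℂ → ℂ
  z - w = z + - w

  ∣_∣² : ℂ → R.Carrier
  ∣ z ∣² = re z R.* re z R.+ im z R.* im z

  -- |z| < r, for use with r > 0, without extracting the square root.
  ∣_∣<_ : ℂ → R.Carrier → Set ℓ₂
  ∣ z ∣< r = ∣ z ∣² R.< r R.* r

  -- z̄ / |z|², hence again 0⁻¹ = 0.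
  infix 8 _⁻¹
  _⁻¹ : ℂ → ℂ
  z ⁻¹ = (re z R.* ∣ z ∣² R.⁻¹) +i ((R.- im z) R.* ∣ z ∣² R.⁻¹)

  infixl 7 _/_
  _/_ : ℂ → ℂ → ℂ
  z / w = z * w ⁻¹

  fromℚ : ℚ → ℂ
  fromℚ q = R.fromℚ q +i R.0#

  infix 4 _≟_
  _≟_ : ∀ z w → Dec (z ≈ w)
  z ≟ w = (re z R.≟ re w) ×-dec (im z R.≟ im w)

  infix 4 _⟶_
  _⟶_ : (ℕ → ℂ) → ℂ → Set (c ⊔ ℓ₂)
  u ⟶ l = ∀ ε → R.0# R.< ε → ∃[ N ] (∀ n → N ℕ.≤ n → ∣ u n - l ∣< ε)

  ℂˣ : Set (c ⊔ ℓ₁)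
  ℂˣ = Σ[ s ∈ ℂ ] ¬ (s ≈ 0#)

  1ˣ : ℂˣ
  1ˣ = 1# , λ (1≈0 , _) →
    IsStrictTotalOrder.irrefl R.isStrictTotalOrder (R.sym 1≈0) R.0<1

  1-ˣ : ∀ (s : ℂˣ) → ¬ (proj₁ s ≈ 1#) → ℂˣ
  1-ˣ (s , _) s≉1 = 1# - s , λ (p , q) → s≉1
    (R.sym (x∙y⁻¹≈ε⇒x≈y _ _ p) , R.sym (x∙y⁻¹≈ε⇒x≈y _ _ q))
    where open GroupProperties R.+-group using (x∙y⁻¹≈ε⇒x≈y)

module Polylogarithms {c ℓ₁ ℓ₂} (ℝ : CompleteOrderedField c ℓ₁ ℓ₂) where

  open ComplexNumbers ℝ public
  private module R = CompleteOrderedField ℝ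

  data Letter : Set (c ⊔ ℓ₁) where
    x : Letter
    y : ℂˣ → Letter

  Word : Set (c ⊔ ℓ₁)
  Word = List Letter

  -- ℚ⟨ x , y_s ∣ s ∈ ℂˣ ⟩: a list represents the sum of its terms q · v.  Distinct
  -- lists may represent the same element; everything below is defined termwise
  -- on representatives.
  𝒜 : Set (c ⊔ ℓ₁)
  𝒜 = List (ℚ × Word)

  letter : Letter → 𝒜
  letter a = (1ℚ , a ∷ []) ∷ []

  infixr 8 _·_
  _·_ : ℚ → 𝒜 → 𝒜
  q · w = map (λ (r , v) → q ℚ.* r , v) w

  infixl 6 _⊕_ _⊖_
  _⊕_ _⊖_ : 𝒜 → 𝒜 → 𝒜
  w ⊕ w′ = w ++ w′
  w ⊖ w′ = w ⊕ (ℚ.- 1ℚ) · w′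

  infixl 7 _⊗_
  _⊗_ : 𝒜 → 𝒜 → 𝒜
  _⊗_ = cartesianProductWith (λ (q , u) (r , v) → q ℚ.* r , u ++ v)

  homWord : (Letter → 𝒜) → Word → 𝒜
  homWord f = foldr (λ a w → f a ⊗ w) ((1ℚ , []) ∷ [])

  -- The ℚ-algebra homomorphism with prescribed values on the letters.
  hom : (Letter → 𝒜) → 𝒜 → 𝒜
  hom f = concatMap (λ (q , v) → q · homWord f v)

  EndsInY : Word → Set (c ⊔ ℓ₁)
  EndsInY v = ∃[ u ] ∃[ s ] v ≡ u ∷ʳ y s

  -- ℚ + Σₛ 𝒜 yₛ.  Every element of this subspace has such a representative.
  infix 4 _∈𝒜¹
  _∈𝒜¹ : 𝒜 → Set (c ⊔ ℓ₁)
  w ∈𝒜¹ = All (λ (_ , v) → v ≡ [] ⊎ EndsInY v) w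

  δ : ℂ → ℚ
  δ s = if ⌊ (s ≟ 0#) ⊎-dec (s ≟ 1#) ⌋ then 0ℚ else 1ℚ

  φ-letter : Letter → 𝒜
  φ-letter x     = letter x ⊕ letter (y 1ˣ)
  φ-letter (y s) = δ (proj₁ s) · letter (y s) ⊖ letter (y 1ˣ)

  φ : 𝒜 → 𝒜
  φ = hom φ-letter

  -- δ(s) y₁₋ₛ, which is 0 for s = 1, although y₀ is not a letter.
  δ·y₁₋ : ℂˣ → 𝒜
  δ·y₁₋ s with proj₁ s ≟ 1#
  ... | yes _  = []
  ... | no s≉1 = δ (proj₁ s) · letter (y (1-ˣ s s≉1))

  -- SIGN.  The source prints  ι(yₛ) = δ(s) y₁₋ₛ − (1 − δ(s)) y₁,  which would give
  -- φι(y₁) = y₁ and hence Li_{y₁}(z) = Li_{y₁}(z/(z−1)), i.e.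
  -- −log(1 − z) = log(1 − z), which is false.  Pulling dz/(1 − z) back along
  -- z = u/(u − 1) gives −du/(1 − u), so φι(y₁) has to be −y₁ and, since
  -- φ(y₁) = −y₁, ι(y₁) has to be +y₁.  The two signs differ only at s = 1.
  ι-letter : Letter → 𝒜
  ι-letter x     = letter x
  ι-letter (y s) = δ·y₁₋ s ⊕ (1ℚ ℚ.- δ (proj₁ s)) · letter (y 1ˣ)

  ι : 𝒜 → 𝒜
  ι = hom ι-letter

  -- The list (k₁ , s₁) , … , (kₙ , sₙ) read off from x^{k₁-1} y_{s₁} ⋯ x^{kₙ-1} y_{sₙ};
  -- the counter is the number of x's since the last y.  Trailing x's are dropped,
  -- but do not occur in 𝒜¹.
  Index : Set (c ⊔ ℓ₁)
  Index = List (ℕ × ℂˣ)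

  indexFrom : ℕ → Word → Index
  indexFrom k []        = []
  indexFrom k (x   ∷ v) = indexFrom (suc k) v
  indexFrom k (y s ∷ v) = (suc k , s) ∷ indexFrom 0 v

  index : Word → Index
  index = indexFrom 0

  ∑< : ℕ → (ℕ → ℂ) → ℂ
  ∑< M f = sum {M} (λ i → f (toℕ i))

  -- The coefficient of z^m in the multiple polylogarithm: with m₁ = m, m_{n+1} = 0,
  --   Σ_{m₁ > m₂ > ⋯ > mₙ > m_{n+1}}  Πᵢ sᵢ^{mᵢ - m_{i+1}} / mᵢ^{kᵢ},
  -- as an iterated sum (m′ is m₂).  The base case enforces m_{n+1} = 0, and the
  -- coefficient of a nonempty index at m = 0 is an empty sum.
  coeff : Index → ℕ → ℂ
  coeff []                    0       = 1#
  coeff []                    (suc _) = 0#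
  coeff ((k , (s , _)) ∷ ks)  m       =
    ∑< m (λ m′ → s ^ (m ∸ m′) * coeff ks m′) / (m ×ₙ 1#) ^ k

  partialSum : Index → ℂ → ℕ → ℂ
  partialSum ks z M = ∑< M (λ m → coeff ks m * z ^ m)

  -- Li w at z ≔ L: the series of every word of w converges at z, and L is the
  -- ℚ-linear combination of their sums.
  data Li_at_≔_ : 𝒜 → ℂ → ℂ → Set (c ⊔ ℓ₁ ⊔ ℓ₂) where
    nil  : ∀ {z L} → L ≈ 0# → Li [] at z ≔ L
    cons : ∀ {q v w z l l′ L} → partialSum (index v) z ⟶ l → Li w at z ≔ l′ →
           L ≈ fromℚ q * l + l′ → Li (q , v) ∷ w at z ≔ L

  -- φ and ι preserve 𝒜¹, so the statement only evaluates Li there.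

  private
    AllEndInY : 𝒜 → Set (c ⊔ ℓ₁)
    AllEndInY = All (λ (_ , v) → EndsInY v)

    ·-All : ∀ {p} {P : Word → Set p} q {w} →
            All (λ (_ , v) → P v) w → All (λ (_ , v) → P v) (q · w)
    ·-All q ps = All.map⁺ ps

    ⊗-AllEndInY : ∀ w {w′} → AllEndInY w′ → AllEndInY (w ⊗ w′)
    ⊗-AllEndInY []            ps = []
    ⊗-AllEndInY ((_ , u) ∷ w) ps = All.++⁺
      (All.map⁺ (All.map (λ { (v , s , refl) → u ++ v , s , sym (++-assoc u v _) }) ps))
      (⊗-AllEndInY w ps)

    ⊗-1 : ∀ {w} → AllEndInY w → AllEndInY (w ⊗ ((1ℚ , []) ∷ []))
    ⊗-1 []                     = []
    ⊗-1 ((v , s , refl) ∷ ps) = (v , s , ++-assoc v _ []) ∷ ⊗-1 ps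

    homWord-AllEndInY : ∀ f → (∀ s → AllEndInY (f (y s))) → ∀ u s →
                        AllEndInY (homWord f (u ∷ʳ y s))
    homWord-AllEndInY f fy []      s = ⊗-1 (fy s)
    homWord-AllEndInY f fy (a ∷ u) s = ⊗-AllEndInY (f a) (homWord-AllEndInY f fy u s)

    y-AllEndInY : ∀ s → AllEndInY (letter (y s))
    y-AllEndInY s = ([] , s , refl) ∷ []

  hom-𝒜¹ : ∀ f → (∀ s → AllEndInY (f (y s))) → ∀ {w} → w ∈𝒜¹ → hom f w ∈𝒜¹
  hom-𝒜¹ f fy []                 = []
  hom-𝒜¹ f fy (_∷_ {q , v} p ps) =
    All.++⁺ (·-All {P = λ v → v ≡ [] ⊎ EndsInY v} q (word p)) (hom-𝒜¹ f fy ps)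
    where
    word : ∀ {v} → v ≡ [] ⊎ EndsInY v → homWord f v ∈𝒜¹
    word (inj₁ refl)           = inj₁ refl ∷ []
    word (inj₂ (u , s , refl)) = All.map inj₂ (homWord-AllEndInY f fy u s)

  φ-𝒜¹ : ∀ {w} → w ∈𝒜¹ → φ w ∈𝒜¹
  φ-𝒜¹ = hom-𝒜¹ φ-letter λ s → All.++⁺
    (·-All {P = EndsInY} (δ (proj₁ s)) (y-AllEndInY s))
    (·-All {P = EndsInY} (ℚ.- 1ℚ) (y-AllEndInY 1ˣ))

  ι-𝒜¹ : ∀ {w} → w ∈𝒜¹ → ι w ∈𝒜¹
  ι-𝒜¹ = hom-𝒜¹ ι-letter λ s → All.++⁺ (δ·y₁₋-AllEndInY s)
    (·-All {P = EndsInY} (1ℚ ℚ.- δ (proj₁ s)) (y-AllEndInY 1ˣ))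
    where
    δ·y₁₋-AllEndInY : ∀ s → AllEndInY (δ·y₁₋ s)
    δ·y₁₋-AllEndInY s with proj₁ s ≟ 1#
    ... | yes _  = []
    ... | no s≉1 = ·-All {P = EndsInY} (δ (proj₁ s)) (y-AllEndInY (1-ˣ s s≉1))

module Submission where

-- Put u = z/(z-1).  Pulling the forms dz/z and s dz/(1-sz) back along z = u/(u-1)
-- gives du/u + du/(1-u) and (1-s)du/(1-(1-s)u) - du/(1-u), which is what φι does to
-- the letters.  So the two sides agree as formal power series in z: substitution
-- of u = z/(z-1) is a linear operator T on coefficient sequences that intertwines
-- the integrations attached to a letter and to its image under φι, and one inducts
-- on words.  The coefficients of Li_w are bounded by a geometric sequence, and for
-- small z the partial sums of F(u) and of (T F)(z) differ by O(2⁻ᴺ).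

open import Defs
open import Algebra.Bundles using (CommutativeRing; Semiring)
import Algebra.Definitions.RawSemiring as RawSemiringDefinitions
import Algebra.Properties.AbelianGroup as AbelianGroupProperties
import Algebra.Properties.CommutativeMonoid.Sum as CommutativeMonoidSum
import Algebra.Properties.Ring as RingProperties
import Algebra.Properties.Semiring.Mult.TCOptimised as MultOptimised
import Algebra.Properties.Semiring.Sum as SemiringSum
import Algebra.Solver.Ring as RingSolver
open import Algebra.Solver.Ring.AlmostCommutativeRing
  using (_-Raw-AlmostCommutative⟶_; fromCommutativeRing)
open import Data.Bool.Base using (if_then_else_)
open import Data.Empty using (⊥-elim)
open import Data.Fin.Base using (toℕ)
open import Data.Integer.Base as ℤ using (ℤ; +_; -[1+_])
import Data.Integer.Properties as ℤ
open import Data.List.Base using ([]; _∷_; _++_; _∷ʳ_; foldr; map)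
open import Data.List.Properties using (foldr-++)
open import Data.List.Relation.Unary.All as All using (All; []; _∷_)
import Data.List.Relation.Unary.All.Properties as All
open import Data.Maybe.Base using (Maybe; just; nothing)
open import Data.Nat.Base as ℕ using (ℕ; zero; suc; _∸_)
import Data.Nat.Properties as ℕ
open import Data.Product using (_×_; _,_; proj₁; proj₂; ∃-syntax)
open import Data.Rational.Base as ℚ using (ℚ; 0ℚ; 1ℚ; ↥_; ↧_; ↧ₙ_; mkℚ)
import Data.Rational.Properties as ℚ
import Data.Rational.Unnormalised.Base as ℚᵘ
import Data.Rational.Unnormalised.Properties as ℚᵘ
open import Data.Sum.Base using (_⊎_; inj₁; inj₂; [_,_]′)
open import Level using (_⊔_)
open import Relation.Binary.Bundles using (StrictPartialOrder)
import Relation.Binary.Construct.StrictToNonStrict as StrictToNonStrict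
open import Relation.Binary.Definitions using (tri<; tri≈; tri>)
open import Relation.Binary.PropositionalEquality as ≡ using (_≡_)
import Relation.Binary.Reasoning.StrictPartialOrder as StrictReasoning
open import Relation.Binary.Structures using (IsStrictTotalOrder)
open import Relation.Nullary.Decidable
  using (yes; no; isYes≗does; dec-true; dec-false; toSum; _⊎-dec_)
open import Relation.Nullary.Negation using (¬_)

-- The intertwining is checked after differentiation: a series with zero constant term is determined
-- by its image under `θ`, and z d/dz becomes (1-u) u d/du, so each letter reduces to an identity
-- between rational functions. Integrating du/u demands a vanishing constant term; this is why words
-- have to end in some y. `T` is defined by a recursion instead of binomial coefficients because the
-- relation u = zu - z, being linear in u, carries over to coefficients, to partial sums and to
-- norms: it defines `U`, drives the remainder estimate and yields the bound of ‖u‖ by 2‖z‖. Words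
-- act on sequences by composing the operators of their letters. Hence φι has to be understood on
-- letters only, and the sums of words that it produces are never expanded. A single rate K, at
-- least 1 and at least 2‖s‖ for every letter y_s in w or in φι(w), bounds all coefficient
-- sequences; on both sides of the identity the point is then so close to 0 that terms decay like
-- 2⁻ⁿ.

-- Integer coefficients for ring identities.

module IntegerCoefficients {c ℓ} (R : CommutativeRing c ℓ) where

  open CommutativeRing R
  open AbelianGroupProperties +-abelianGroup using (⁻¹-∙-comm; ε⁻¹≈ε; ⁻¹-involutive)
  open RingProperties ring using (-‿distribˡ-*; -‿distribʳ-*)
  open MultOptimised semiring using (1+×; ×-homo-+; ×1-homo-*) renaming (_×_ to _×ₙ_)
  open import Relation.Binary.Reasoning.Setoid setoid

  infix 10 ⟦_⟧ᶻ
  -- With the optimised multiple, `⟦ + 1 ⟧ᶻ` is `1#` by computation, so the numeral `con (+ 1)` of a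
  -- solved identity matches `1#` in the goal.
  ⟦_⟧ᶻ : ℤ → Carrier
  ⟦ + n ⟧ᶻ      = n ×ₙ 1#
  ⟦ -[1+ n ] ⟧ᶻ = - (suc n ×ₙ 1#)

  ⟦neg⟧ᶻ : ∀ i → ⟦ ℤ.- i ⟧ᶻ ≈ - ⟦ i ⟧ᶻ
  ⟦neg⟧ᶻ (+ zero)  = sym ε⁻¹≈ε
  ⟦neg⟧ᶻ (+ suc n) = refl
  ⟦neg⟧ᶻ -[1+ n ]  = sym (⁻¹-involutive _)

  private
    cancel : ∀ a b → (1# + a) - (1# + b) ≈ a - b
    cancel a b = begin
      (1# + a) + - (1# + b)     ≈⟨ +-congˡ (⁻¹-∙-comm 1# b) ⟨
      (1# + a) + (- 1# + - b)   ≈⟨ +-congʳ (+-comm 1# a) ⟩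
      (a + 1#) + (- 1# + - b)   ≈⟨ +-assoc _ _ _ ⟩
      a + (1# + (- 1# + - b))   ≈⟨ +-congˡ (+-assoc _ _ _) ⟨
      a + ((1# + - 1#) + - b)   ≈⟨ +-congˡ (+-congʳ (-‿inverseʳ 1#)) ⟩
      a + (0# + - b)            ≈⟨ +-congˡ (+-identityˡ _) ⟩
      a + - b                   ∎

  ⟦⊖⟧ᶻ : ∀ m n → ⟦ m ℤ.⊖ n ⟧ᶻ ≈ m ×ₙ 1# - n ×ₙ 1#
  ⟦⊖⟧ᶻ m       zero    = sym (trans (+-congˡ ε⁻¹≈ε) (+-identityʳ _))
  ⟦⊖⟧ᶻ zero    (suc n) = sym (+-identityˡ _)
  ⟦⊖⟧ᶻ (suc m) (suc n) = begin
    ⟦ suc m ℤ.⊖ suc n ⟧ᶻ              ≡⟨ ≡.cong ⟦_⟧ᶻ (ℤ.[1+m]⊖[1+n]≡m⊖n m n) ⟩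
    ⟦ m ℤ.⊖ n ⟧ᶻ                      ≈⟨ ⟦⊖⟧ᶻ m n ⟩
    m ×ₙ 1# - n ×ₙ 1#                   ≈⟨ cancel _ _ ⟨
    (1# + m ×ₙ 1#) - (1# + n ×ₙ 1#)     ≈⟨ +-cong (1+× m 1#) (-‿cong (1+× n 1#)) ⟨
    suc m ×ₙ 1# - suc n ×ₙ 1#           ∎

  ⟦+⟧ᶻ : ∀ i j → ⟦ i ℤ.+ j ⟧ᶻ ≈ ⟦ i ⟧ᶻ + ⟦ j ⟧ᶻ
  ⟦+⟧ᶻ (+ m)    (+ n)    = ×-homo-+ 1# m n
  ⟦+⟧ᶻ (+ m)    -[1+ n ] = ⟦⊖⟧ᶻ m (suc n)
  ⟦+⟧ᶻ -[1+ m ] (+ n)    = trans (⟦⊖⟧ᶻ n (suc m)) (+-comm _ _)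
  ⟦+⟧ᶻ -[1+ m ] -[1+ n ] = begin
    - (suc (suc (m ℕ.+ n)) ×ₙ 1#)          ≡⟨ ≡.cong (λ k → - (suc k ×ₙ 1#)) (ℕ.+-suc m n) ⟨
    - ((suc m ℕ.+ suc n) ×ₙ 1#)            ≈⟨ -‿cong (×-homo-+ 1# (suc m) (suc n)) ⟩
    - (suc m ×ₙ 1# + suc n ×ₙ 1#)           ≈⟨ ⁻¹-∙-comm _ _ ⟨
    - (suc m ×ₙ 1#) + - (suc n ×ₙ 1#)       ∎

  private
    ⟦+*⟧ᶻ : ∀ m j → ⟦ + m ℤ.* j ⟧ᶻ ≈ m ×ₙ 1# * ⟦ j ⟧ᶻ
    ⟦+*⟧ᶻ m (+ n)    = begin
      ⟦ + m ℤ.* + n ⟧ᶻ    ≡⟨ ≡.cong ⟦_⟧ᶻ (ℤ.pos-* m n) ⟨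
      (m ℕ.* n) ×ₙ 1#      ≈⟨ ×1-homo-* m n ⟩
      m ×ₙ 1# * (n ×ₙ 1#)   ∎
    ⟦+*⟧ᶻ m -[1+ n ] = begin
      ⟦ + m ℤ.* (ℤ.- (+ suc n)) ⟧ᶻ   ≡⟨ ≡.cong ⟦_⟧ᶻ (ℤ.neg-distribʳ-* (+ m) (+ suc n)) ⟨
      ⟦ ℤ.- (+ m ℤ.* + suc n) ⟧ᶻ     ≈⟨ ⟦neg⟧ᶻ (+ m ℤ.* + suc n) ⟩
      - ⟦ + m ℤ.* + suc n ⟧ᶻ         ≈⟨ -‿cong (⟦+*⟧ᶻ m (+ suc n)) ⟩
      - (m ×ₙ 1# * (suc n ×ₙ 1#))      ≈⟨ -‿distribʳ-* _ _ ⟩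
      m ×ₙ 1# * - (suc n ×ₙ 1#)        ∎

  ⟦*⟧ᶻ : ∀ i j → ⟦ i ℤ.* j ⟧ᶻ ≈ ⟦ i ⟧ᶻ * ⟦ j ⟧ᶻ
  ⟦*⟧ᶻ (+ m)    j = ⟦+*⟧ᶻ m j
  ⟦*⟧ᶻ -[1+ m ] j = begin
    ⟦ (ℤ.- (+ suc m)) ℤ.* j ⟧ᶻ   ≡⟨ ≡.cong ⟦_⟧ᶻ (ℤ.neg-distribˡ-* (+ suc m) j) ⟨
    ⟦ ℤ.- (+ suc m ℤ.* j) ⟧ᶻ     ≈⟨ ⟦neg⟧ᶻ (+ suc m ℤ.* j) ⟩
    - ⟦ + suc m ℤ.* j ⟧ᶻ         ≈⟨ -‿cong (⟦+*⟧ᶻ (suc m) j) ⟩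
    - (suc m ×ₙ 1# * ⟦ j ⟧ᶻ)      ≈⟨ -‿distribˡ-* _ _ ⟩
    - (suc m ×ₙ 1#) * ⟦ j ⟧ᶻ      ∎

  private
    morphism : ℤ.+-*-rawRing -Raw-AlmostCommutative⟶ fromCommutativeRing R
    morphism = record
      { ⟦_⟧    = ⟦_⟧ᶻ
      ; +-homo = ⟦+⟧ᶻ
      ; *-homo = ⟦*⟧ᶻ
      ; -‿homo = ⟦neg⟧ᶻ
      ; 0-homo = refl
      ; 1-homo = refl
      }

    _≟ᶜ_ : ∀ i j → Maybe (⟦ i ⟧ᶻ ≈ ⟦ j ⟧ᶻ)
    i ≟ᶜ j with i ℤ.≟ j
    ... | yes ≡.refl = just refl
    ... | no  _      = nothing

  open RingSolver ℤ.+-*-rawRing (fromCommutativeRing R) morphism _≟ᶜ_ public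
    using (solve; con; _:+_; _:-_; _:*_; :-_; _:=_)

-- The substitution u = z/(z-1) on formal power series.

module FormalSubstitution {c ℓ} (R : CommutativeRing c ℓ) where

  open CommutativeRing R
  open RawSemiringDefinitions (Semiring.rawSemiring semiring) using () renaming (_×_ to _×ₙ_)
  open IntegerCoefficients R
  open import Relation.Binary.Reasoning.Setoid setoid

  Seq : Set c
  Seq = ℕ → Carrier

  infix 4 _≋_
  _≋_ : Seq → Seq → Set ℓ
  c ≋ d = ∀ n → c n ≈ d n

  tail : Seq → Seq
  tail c n = c (suc n)

  shift : Seq → Seq
  shift c zero    = 0#
  shift c (suc n) = c n

  infixl 6 _+ˢ_
  _+ˢ_ : Seq → Seq → Seq
  (c +ˢ d) n = c n + d n

  infixr 7 _*ˢ_
  _*ˢ_ : Carrier → Seq → Seq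
  (a *ˢ c) n = a * c n

  0ˢ : Seq
  0ˢ _ = 0#

  -- If c is the coefficient sequence of F, then T c is that of F(z/(z-1)), and
  -- U c = T (shift c) that of (z/(z-1)) F(z/(z-1)).  The recursion for U reads off
  -- z/(z-1) = z (z/(z-1) - 1).
  T U : Seq → Seq
  T c zero    = c 0
  T c (suc n) = U (tail c) (suc n)
  U c zero    = 0#
  U c (suc n) = U c n - T c n

  T-shift : ∀ c → T (shift c) ≋ U c
  T-shift c zero    = refl
  T-shift c (suc n) = refl

  T-cong : ∀ {c d} → c ≋ d → T c ≋ T d
  U-cong : ∀ {c d} → c ≋ d → U c ≋ U d
  T-cong p zero    = p 0
  T-cong p (suc n) = U-cong (λ m → p (suc m)) (suc n)
  U-cong p zero    = refl
  U-cong p (suc n) = +-cong (U-cong p n) (-‿cong (T-cong p n))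

  T-+ : ∀ c d → T (c +ˢ d) ≋ T c +ˢ T d
  U-+ : ∀ c d → U (c +ˢ d) ≋ U c +ˢ U d
  T-+ c d zero    = refl
  T-+ c d (suc n) = U-+ (tail c) (tail d) (suc n)
  U-+ c d zero    = sym (+-identityˡ 0#)
  U-+ c d (suc n) = trans (+-cong (U-+ c d n) (-‿cong (T-+ c d n)))
    (solve 4 (λ a b e f → (a :+ b) :- (e :+ f) := (a :- e) :+ (b :- f)) refl _ _ _ _)

  T-* : ∀ a c → T (a *ˢ c) ≋ a *ˢ T c
  U-* : ∀ a c → U (a *ˢ c) ≋ a *ˢ U c
  T-* a c zero    = refl
  T-* a c (suc n) = U-* a (tail c) (suc n)
  U-* a c zero    = sym (zeroʳ a)
  U-* a c (suc n) = trans (+-cong (U-* a c n) (-‿cong (T-* a c n)))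
    (solve 3 (λ a e f → a :* e :- a :* f := a :* (e :- f)) refl _ _ _)

  T-0 : T 0ˢ ≋ 0ˢ
  T-0 n = begin
    T 0ˢ n          ≈⟨ T-cong (λ _ → zeroˡ 0#) n ⟨
    T (0# *ˢ 0ˢ) n  ≈⟨ T-* 0# 0ˢ n ⟩
    0# * T 0ˢ n     ≈⟨ zeroˡ _ ⟩
    0#              ∎

  θ : Seq → Seq
  θ c n = n ×ₙ 1# * c n

  private
    θ-tail : ∀ c → tail (θ c) ≋ θ (tail c) +ˢ tail c
    θ-tail c n = solve 2 (λ m a → (con (+ 1) :+ m) :* a := m :* a :+ a) refl _ _

  -- z d/dz (F(z/(z-1))) = ((1 - u) (u d/du) F)(u) at u = z/(z-1).
  θ-T : ∀ c → θ (T c) ≋ (λ n → T (θ c) n - U (θ c) n)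
  private
    -- The identity `θ-T` for uF in place of F: the Leibniz rule turns u d/du (uF) into u (u dF/du +
    -- F). The two are proved together because `T` at `suc n` is a value of `U`, while `U` at
    -- `suc n` uses both at `n`.
    θ-U : ∀ c → θ (U c) ≋
          (λ n → U (θ c +ˢ c) n - U (shift (θ c +ˢ c)) n)

    -- `θ c` has no constant term, so it is u times its tail.
    U-θ : ∀ c → U (θ c) ≋ U (shift (tail (θ c)))
    U-θ c = U-cong λ { zero → zeroˡ _ ; (suc _) → refl }

  θ-T c zero    = solve 1 (λ a → con (+ 0) :* a := con (+ 0) :* a :- con (+ 0)) refl _
  θ-T c (suc n) = trans (θ-U (tail c) (suc n)) (+-cong
    (sym (U-cong (θ-tail c) (suc n)))
    (-‿cong (sym (trans (U-θ c (suc n))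
      (U-cong (λ { zero → refl ; (suc m) → θ-tail c m }) (suc n))))))

  θ-U c zero    = solve 0 (con (+ 0) :* con (+ 0) := con (+ 0) :- con (+ 0)) refl
  θ-U c (suc n) = begin
    (1# + N) * (U c n - T c n)
      ≈⟨ solve 3 (λ m a b → (con (+ 1) :+ m) :* (a :- b) := (m :* a :- m :* b) :+ (a :- b)) refl N (U c n) (T c n) ⟩
    (N * U c n - N * T c n) + (U c n - T c n)
      ≈⟨ +-congʳ (+-cong (θ-U c n) (-‿cong (θ-T c n))) ⟩
    ((U e n - U (shift e) n) - (T (θ c) n - U (θ c) n)) + (U c n - T c n)
      ≈⟨ solve 6 (λ p q a b a′ b′ → ((p :- q) :- (a :- b)) :+ (b′ :- a′) := ((b :+ b′) :- (a :+ a′)) :- (q :- p)) refl _ _ _ _ _ _ ⟩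
    ((U (θ c) n + U c n) - (T (θ c) n + T c n)) - (U (shift e) n - U e n)
      ≈⟨ +-cong (+-cong (U-+ (θ c) c n) (-‿cong (T-+ (θ c) c n))) (-‿cong (+-congˡ (-‿cong (T-shift e n)))) ⟨
    (U e n - T e n) - (U (shift e) n - T (shift e) n) ∎
    where
    N = n ×ₙ 1#
    e = θ c +ˢ c

  -- The coefficients of sz/(1-sz) F.
  Geo : Carrier → Seq → Seq
  Geo s c zero    = 0#
  Geo s c (suc n) = s * (Geo s c n + c n)

  Geo-cong : ∀ {s t c d} → s ≈ t → c ≋ d → Geo s c ≋ Geo t d
  Geo-cong p q zero    = refl
  Geo-cong p q (suc n) = *-cong p (+-cong (Geo-cong p q n) (q n))

  Geo-+ : ∀ s c d → Geo s (c +ˢ d) ≋ Geo s c +ˢ Geo s d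
  Geo-+ s c d zero    = sym (+-identityˡ 0#)
  Geo-+ s c d (suc n) = trans (*-congˡ (+-congʳ (Geo-+ s c d n)))
    (solve 5 (λ s a b c d → s :* ((a :+ b) :+ (c :+ d)) := s :* (a :+ c) :+ s :* (b :+ d)) refl _ _ _ _ _)

  Geo-* : ∀ s a c → Geo s (a *ˢ c) ≋ a *ˢ Geo s c
  Geo-* s a c zero    = sym (zeroʳ a)
  Geo-* s a c (suc n) = trans (*-congˡ (+-congʳ (Geo-* s a c n)))
    (solve 4 (λ s a b c → s :* (a :* b :+ a :* c) := a :* (s :* (b :+ c))) refl _ _ _ _)

  Geo-0 : ∀ c → Geo 0# c ≋ 0ˢ
  Geo-0 c zero    = refl
  Geo-0 c (suc n) = zeroˡ _

  module Integration (inv : ℕ → Carrier)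
                     (inv-inverse : ∀ n → suc n ×ₙ 1# * inv n ≈ 1#) where

    -- Coefficients of ∫ F dz/z; the constant coefficient of F is ignored.
    ∫ : Seq → Seq
    ∫ c zero    = 0#
    ∫ c (suc n) = c (suc n) * inv n

    ∫-cong : ∀ {c d} → c ≋ d → ∫ c ≋ ∫ d
    ∫-cong p zero    = refl
    ∫-cong p (suc n) = *-congʳ (p (suc n))

    ∫-+ : ∀ c d → ∫ (c +ˢ d) ≋ ∫ c +ˢ ∫ d
    ∫-+ c d zero    = sym (+-identityˡ 0#)
    ∫-+ c d (suc n) = distribʳ _ _ _

    ∫-* : ∀ a c → ∫ (a *ˢ c) ≋ a *ˢ ∫ c
    ∫-* a c zero    = sym (zeroʳ a)
    ∫-* a c (suc n) = *-assoc _ _ _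

    θ-∫ : ∀ c → c 0 ≈ 0# → θ (∫ c) ≋ c
    θ-∫ c p zero    = trans (zeroˡ _) (sym p)
    θ-∫ c p (suc n) = begin
      suc n ×ₙ 1# * (c (suc n) * inv n)  ≈⟨ solve 3 (λ m a i → m :* (a :* i) := a :* (m :* i)) refl _ _ _ ⟩
      c (suc n) * (suc n ×ₙ 1# * inv n)  ≈⟨ *-congˡ (inv-inverse n) ⟩
      c (suc n) * 1#                     ≈⟨ *-identityʳ _ ⟩
      c (suc n)                          ∎

    ∫-θ : ∀ c → c 0 ≈ 0# → ∫ (θ c) ≋ c
    ∫-θ c p zero    = sym p
    ∫-θ c p (suc n) = trans
      (solve 3 (λ m a i → (m :* a) :* i := a :* (m :* i)) refl _ _ _)
      (trans (*-congˡ (inv-inverse n)) (*-identityʳ _))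

    -- Change of variables for du/u: if F is the integral of f du/u, then z d/dz F(u) = (1-u) f(u),
    -- which the hypothesis identifies with g. Both sides have zero constant term, so it is enough
    -- that `θ` agrees on them.
    T-∫ : ∀ f g → f 0 ≈ 0# → (λ n → T f n - U f n) ≋ g → T (∫ f) ≋ ∫ g
    T-∫ f g f₀ p n = begin
      T (∫ f) n         ≈⟨ ∫-θ (T (∫ f)) refl n ⟨
      ∫ (θ (T (∫ f))) n ≈⟨ ∫-cong θT∫ n ⟩
      ∫ g n             ∎
      where
      θT∫ : θ (T (∫ f)) ≋ g
      θT∫ m = begin
        θ (T (∫ f)) m                    ≈⟨ θ-T (∫ f) m ⟩
        T (θ (∫ f)) m - U (θ (∫ f)) m    ≈⟨ +-cong (T-cong (θ-∫ f f₀) m) (-‿cong (U-cong (θ-∫ f f₀) m)) ⟩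
        T f m - U f m                    ≈⟨ p m ⟩
        g m                              ∎

    X : Seq → Seq
    X = ∫

    -- Integration against s dz/(1-sz), written as sz/(1-sz) times dz/z.
    Y : Carrier → Seq → Seq
    Y s c = ∫ (Geo s c)

    -- The two integrands add up to f = c/(1-u), so (1-u) f is c itself. The condition on `c 0`
    -- makes f du/u integrable as a power series.
    T-X : ∀ c → c 0 ≈ 0# → T (X c +ˢ Y 1# c) ≋ X (T c)
    T-X c c₀ n = begin
      T (∫ c +ˢ ∫ (Geo 1# c)) n   ≈⟨ T-cong (∫-+ c (Geo 1# c)) n ⟨
      T (∫ f) n                   ≈⟨ T-∫ f (T c) (trans (+-cong c₀ refl) (+-identityˡ 0#)) Tf-Uf n ⟩
      ∫ (T c) n                   ∎
      where
      f = c +ˢ Geo 1# c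

      -- The equation f = c/(1-u) in the form f = c + uf.
      f-unfold : f ≋ c +ˢ shift f
      f-unfold zero    = refl
      f-unfold (suc m) = +-congˡ (trans (*-identityˡ _) (+-comm _ _))

      Tf-Uf : (λ m → T f m - U f m) ≋ T c
      Tf-Uf m = begin
        T f m - U f m                      ≈⟨ +-congʳ (T-cong f-unfold m) ⟩
        T (c +ˢ shift f) m - U f m         ≈⟨ +-congʳ (T-+ c (shift f) m) ⟩
        T c m + T (shift f) m - U f m      ≈⟨ +-congʳ (+-congˡ (T-shift f m)) ⟩
        T c m + U f m - U f m              ≈⟨ solve 2 (λ a b → a :+ b :- b := a) refl _ _ ⟩
        T c m                              ∎

    -- The series G given by `Geo s c` satisfies G = su (G + c); applying `T` turns the factor u
    -- into `U`.
    T-Geo : ∀ s c n → T (Geo s c) n ≈ s * (U (Geo s c) n + U c n)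
    T-Geo s c n = begin
      T (Geo s c) n                       ≈⟨ T-cong unfold n ⟩
      T (s *ˢ shift (Geo s c +ˢ c)) n     ≈⟨ T-* s _ n ⟩
      s * T (shift (Geo s c +ˢ c)) n      ≈⟨ *-congˡ (T-shift _ n) ⟩
      s * U (Geo s c +ˢ c) n              ≈⟨ *-congˡ (U-+ (Geo s c) c n) ⟩
      s * (U (Geo s c) n + U c n)         ∎
      where
      unfold : Geo s c ≋ s *ˢ shift (Geo s c +ˢ c)
      unfold zero    = sym (zeroʳ s)
      unfold (suc m) = refl

    -- With t = 1-s, the integrand times 1-u has the factor (1-u) (tu/(1-tu) - u/(1-u)) =
    -- -su/(1-tu), and this is sz/(1-sz) at u = z/(z-1).
    T-Y : ∀ s c → T (Y (1# - s) c +ˢ (- 1#) *ˢ Y 1# c) ≋ Y s (T c)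
    T-Y s c n = begin
      T (∫ A +ˢ - 1# *ˢ ∫ B) n   ≈⟨ T-cong ∫f n ⟨
      T (∫ f) n                  ≈⟨ T-∫ f (Geo s (T c)) f₀ Tf-Uf n ⟩
      ∫ (Geo s (T c)) n          ∎
      where
      A = Geo (1# - s) c
      B = Geo 1# c
      f = A +ˢ - 1# *ˢ B

      ∫f : ∫ f ≋ ∫ A +ˢ - 1# *ˢ ∫ B
      ∫f m = trans (∫-+ A (- 1# *ˢ B) m) (+-congˡ (∫-* (- 1#) B m))

      f₀ : f 0 ≈ 0#
      f₀ = solve 0 (con (+ 0) :+ :- con (+ 1) :* con (+ 0) := con (+ 0)) refl

      -- Here A + c = c/(1-tu) with t = 1-s, so the left side is -su/(1-tu) times c(u). It obeys the
      -- recursion that defines `Geo s (T c)`, once `T-Geo` has expressed `T A` through `U`.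
      UA+Uc : ∀ m → - (s * (U A m + U c m)) ≈ Geo s (T c) m
      UA+Uc zero    = solve 1 (λ s → :- (s :* (con (+ 0) :+ con (+ 0))) := con (+ 0)) refl s
      UA+Uc (suc m) = begin
        - (s * ((U A m - T A m) + (U c m - T c m)))
          ≈⟨ -‿cong (*-congˡ (+-congʳ (+-congˡ (-‿cong (T-Geo (1# - s) c m))))) ⟩
        - (s * ((U A m - (1# - s) * (U A m + U c m)) + (U c m - T c m)))
          ≈⟨ solve 4 (λ s a u t → :- (s :* ((a :- (con (+ 1) :- s) :* (a :+ u)) :+ (u :- t)))
                               := s :* (:- (s :* (a :+ u)) :+ t)) refl _ _ _ _ ⟩
        s * (- (s * (U A m + U c m)) + T c m)
          ≈⟨ *-congˡ (+-congʳ (UA+Uc m)) ⟩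
        s * (Geo s (T c) m + T c m) ∎

      Tf-Uf : (λ m → T f m - U f m) ≋ Geo s (T c)
      Tf-Uf m = begin
        T f m - U f m
          ≈⟨ +-cong (trans (T-+ A _ m) (+-congˡ (T-* (- 1#) B m))) (-‿cong (trans (U-+ A _ m) (+-congˡ (U-* (- 1#) B m)))) ⟩
        (T A m + - 1# * T B m) - (U A m + - 1# * U B m)
          ≈⟨ +-congʳ (+-cong (T-Geo (1# - s) c m) (*-congˡ (T-Geo 1# c m))) ⟩
        ((1# - s) * (U A m + U c m) + - 1# * (1# * (U B m + U c m))) - (U A m + - 1# * U B m)
          ≈⟨ solve 4 (λ s a b u → ((con (+ 1) :- s) :* (a :+ u) :+ :- con (+ 1) :* (con (+ 1) :* (b :+ u))) :- (a :+ :- con (+ 1) :* b)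
                               := :- (s :* (a :+ u))) refl _ _ _ _ ⟩
        - (s * (U A m + U c m))
          ≈⟨ UA+Uc m ⟩
        Geo s (T c) m ∎

-- Order, absolute value and geometric convergence in the reals.

module OrderedField {c ℓ₁ ℓ₂} (ℝ : CompleteOrderedField c ℓ₁ ℓ₂) where

  open CompleteOrderedField ℝ
  open IsStrictTotalOrder isStrictTotalOrder public
    using (isStrictPartialOrder) renaming (trans to <-trans; irrefl to <-irrefl)
  open IntegerCoefficients commutativeRing
  open StrictToNonStrict _≈_ _<_ public using (_≤_)

  strictPartialOrder : StrictPartialOrder c ℓ₁ ℓ₂
  strictPartialOrder = record { isStrictPartialOrder = isStrictPartialOrder }

  module ≤-Reasoning = StrictReasoning strictPartialOrder
  open ≤-Reasoning

  ≤-trans : ∀ {x y z} → x ≤ y → y ≤ z → x ≤ z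
  ≤-trans {x} {y} {z} p q = begin x ≤⟨ p ⟩ y ≤⟨ q ⟩ z ∎

  <-≤-trans : ∀ {x y z} → x < y → y ≤ z → x < z
  <-≤-trans {x} {y} {z} p q = begin-strict x <⟨ p ⟩ y ≤⟨ q ⟩ z ∎

  ≤-<-trans : ∀ {x y z} → x ≤ y → y < z → x < z
  ≤-<-trans {x} {y} {z} p q = begin-strict x ≤⟨ p ⟩ y <⟨ q ⟩ z ∎

  ≤-refl : ∀ {x} → x ≤ x
  ≤-refl = inj₂ refl

  ≤-resp : ∀ {x y x′ y′} → x ≈ x′ → y ≈ y′ → x ≤ y → x′ ≤ y′
  ≤-resp p q r = ≤-trans (inj₂ (sym p)) (≤-trans r (inj₂ q))

  <-resp : ∀ {x y x′ y′} → x ≈ x′ → y ≈ y′ → x < y → x′ < y′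
  <-resp p q r = ≤-<-trans (inj₂ (sym p)) (<-≤-trans r (inj₂ q))

  <⇒≱ : ∀ {x y} → x < y → ¬ (y ≤ x)
  <⇒≱ p q = <-irrefl refl (<-≤-trans p q)

  ≤-or-> : ∀ x y → x ≤ y ⊎ y < x
  ≤-or-> x y with compare x y
  ... | tri< p _ _ = inj₁ (inj₁ p)
  ... | tri≈ _ p _ = inj₁ (inj₂ p)
  ... | tri> _ _ p = inj₂ p

  +-monoˡ-≤ : ∀ z {x y} → x ≤ y → x + z ≤ y + z
  +-monoˡ-≤ z (inj₁ p) = inj₁ (+-monoˡ-< z p)
  +-monoˡ-≤ z (inj₂ p) = inj₂ (+-congʳ p)

  +-mono-≤ : ∀ {x y u v} → x ≤ y → u ≤ v → x + u ≤ y + v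
  +-mono-≤ {x} {y} {u} {v} p q = begin
    x + u ≤⟨ +-monoˡ-≤ u p ⟩
    y + u ≈⟨ +-comm y u ⟩
    u + y ≤⟨ +-monoˡ-≤ y q ⟩
    v + y ≈⟨ +-comm v y ⟩
    y + v ∎

  +-mono-< : ∀ {x y u v} → x < y → u < v → x + u < y + v
  +-mono-< {x} {y} {u} {v} p q = begin-strict
    x + u <⟨ +-monoˡ-< u p ⟩
    y + u ≈⟨ +-comm y u ⟩
    u + y <⟨ +-monoˡ-< y q ⟩
    v + y ≈⟨ +-comm v y ⟩
    y + v ∎

  x≤x+y : ∀ {x y} → 0# ≤ y → x ≤ x + y
  x≤x+y p = ≤-resp (+-identityʳ _) refl (+-mono-≤ ≤-refl p)

  y≤x+y : ∀ {x y} → 0# ≤ x → y ≤ x + y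
  y≤x+y p = ≤-resp refl (+-comm _ _) (x≤x+y p)

  x≤y⇒0≤y-x : ∀ {x y} → x ≤ y → 0# ≤ y - x
  x≤y⇒0≤y-x {x} p = ≤-resp (-‿inverseʳ x) refl (+-monoˡ-≤ (- x) p)

  x<y⇒0<y-x : ∀ {x y} → x < y → 0# < y - x
  x<y⇒0<y-x {x} p = <-resp (-‿inverseʳ x) refl (+-monoˡ-< (- x) p)

  private
    y-x+x : ∀ x y → (y - x) + x ≈ y
    y-x+x = solve 2 (λ x y → (y :- x) :+ x := y) refl

  0≤y-x⇒x≤y : ∀ {x y} → 0# ≤ y - x → x ≤ y
  0≤y-x⇒x≤y {x} {y} p = ≤-resp (+-identityˡ x) (y-x+x x y) (+-monoˡ-≤ x p)

  0<y-x⇒x<y : ∀ {x y} → 0# < y - x → x < y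
  0<y-x⇒x<y {x} {y} p = <-resp (+-identityˡ x) (y-x+x x y) (+-monoˡ-< x p)

  -‿mono-≤ : ∀ {x y} → x ≤ y → - y ≤ - x
  -‿mono-≤ {x} {y} p = 0≤y-x⇒x≤y
    (≤-resp refl (solve 2 (λ x y → y :- x := :- x :- :- y) refl x y) (x≤y⇒0≤y-x p))

  -‿mono-< : ∀ {x y} → x < y → - y < - x
  -‿mono-< {x} {y} p = 0<y-x⇒x<y
    (<-resp refl (solve 2 (λ x y → y :- x := :- x :- :- y) refl x y) (x<y⇒0<y-x p))

  -0≈0 : - 0# ≈ 0#
  -0≈0 = solve 0 (:- con (+ 0) := con (+ 0)) refl

  0≤* : ∀ {x y} → 0# ≤ x → 0# ≤ y → 0# ≤ x * y
  0≤* (inj₁ p) (inj₁ q)       = inj₁ (*-pos p q)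
  0≤* (inj₁ p) (inj₂ q)       = inj₂ (trans (sym (zeroʳ _)) (*-congˡ q))
  0≤* {y = y} (inj₂ p) q      = inj₂ (trans (sym (zeroˡ y)) (*-congʳ p))

  *-monoʳ-≤ : ∀ {z x y} → 0# ≤ z → x ≤ y → z * x ≤ z * y
  *-monoʳ-≤ {z} {x} {y} p q = 0≤y-x⇒x≤y
    (≤-resp refl (solve 3 (λ x y z → z :* (y :- x) := z :* y :- z :* x) refl x y z)
      (0≤* p (x≤y⇒0≤y-x q)))

  *-monoˡ-≤ : ∀ {z x y} → 0# ≤ z → x ≤ y → x * z ≤ y * z
  *-monoˡ-≤ p q = ≤-resp (*-comm _ _) (*-comm _ _) (*-monoʳ-≤ p q)

  *-mono-≤ : ∀ {x y u v} → 0# ≤ u → 0# ≤ y → x ≤ y → u ≤ v → x * u ≤ y * v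
  *-mono-≤ p q r s = ≤-trans (*-monoˡ-≤ p r) (*-monoʳ-≤ q s)

  *-monoʳ-< : ∀ {z x y} → 0# < z → x < y → z * x < z * y
  *-monoʳ-< {z} {x} {y} p q = 0<y-x⇒x<y
    (<-resp refl (solve 3 (λ x y z → z :* (y :- x) := z :* y :- z :* x) refl x y z)
      (*-pos p (x<y⇒0<y-x q)))

  *-monoˡ-< : ∀ {z x y} → 0# < z → x < y → x * z < y * z
  *-monoˡ-< p q = <-resp (*-comm _ _) (*-comm _ _) (*-monoʳ-< p q)

  0≤1 : 0# ≤ 1#
  0≤1 = inj₁ 0<1

  ×ₙ-mono : ∀ {m n} → m ℕ.≤ n → m ×ₙ 1# ≤ n ×ₙ 1#
  ×ₙ-mono {n = zero}  ℕ.z≤n     = ≤-refl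
  ×ₙ-mono {n = suc n} ℕ.z≤n     = ≤-trans (×ₙ-mono {n = n} ℕ.z≤n) (y≤x+y 0≤1)
  ×ₙ-mono             (ℕ.s≤s p) = +-mono-≤ ≤-refl (×ₙ-mono p)

  1≤suc : ∀ n → 1# ≤ suc n ×ₙ 1#
  1≤suc n = x≤x+y (×ₙ-mono {n = n} ℕ.z≤n)

  ^-pos : ∀ {x} n → 0# < x → 0# < x ^ n
  ^-pos zero    p = 0<1
  ^-pos (suc n) p = *-pos p (^-pos n p)

  0≤^ : ∀ {x} n → 0# ≤ x → 0# ≤ x ^ n
  0≤^ zero    p = 0≤1
  0≤^ (suc n) p = 0≤* p (0≤^ n p)

  >⇒≉ : ∀ {x} → 0# < x → ¬ (x ≈ 0#)
  >⇒≉ p q = <-irrefl (sym q) p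

  *-inverse : ∀ {x} → ¬ (x ≈ 0#) → x * x ⁻¹ ≈ 1#
  *-inverse {x} x≉0 with x ≟ 0#
  ... | yes p = ⊥-elim (x≉0 p)
  ... | no p  = proj₂ (inverse x p)

  *≈1⇒pos : ∀ {x y} → 0# < x → x * y ≈ 1# → 0# < y
  *≈1⇒pos {x} {y} p q with ≤-or-> y 0#
  ... | inj₂ r = r
  ... | inj₁ r = ⊥-elim (<⇒≱ 0<1 (≤-resp q (zeroʳ x) (*-monoʳ-≤ (inj₁ p) r)))

  ⁻¹-pos : ∀ {x} → 0# < x → 0# < x ⁻¹
  ⁻¹-pos p = *≈1⇒pos p (*-inverse (>⇒≉ p))

  0<2 : 0# < 1# + 1#
  0<2 = <-resp (+-identityˡ 0#) refl (+-mono-< 0<1 0<1)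

  opaque
    -- 1/2, the ratio of all geometric series below.
    h : Carrier
    h = (1# + 1#) ⁻¹

    0<h : 0# < h
    0<h = ⁻¹-pos 0<2

    2h≈1 : (1# + 1#) * h ≈ 1#
    2h≈1 = *-inverse (>⇒≉ 0<2)

  0≤h : 0# ≤ h
  0≤h = inj₁ 0<h

  h+h≈1 : h + h ≈ 1#
  h+h≈1 = trans (solve 1 (λ h → h :+ h := (con (+ 1) :+ con (+ 1)) :* h) refl h) 2h≈1

  halves : ∀ ε → h * ε + h * ε ≈ ε
  halves ε = trans (sym (distribʳ ε h h)) (trans (*-congʳ h+h≈1) (*-identityˡ ε))

  h<1 : h < 1#
  h<1 = <-resp (+-identityˡ h) h+h≈1 (+-monoˡ-< h 0<h)

  h^-halves : ∀ A n → A * h ^ n ≈ A * h ^ suc n + A * h ^ suc n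
  h^-halves A n = sym (trans
    (solve 3 (λ a h p → a :* (h :* p) :+ a :* (h :* p) := a :* p :* (h :+ h)) refl A h (h ^ n))
    (trans (*-congˡ h+h≈1) (*-identityʳ _)))

  -- This is n ≤ 2ⁿ. Together with the Archimedean property it drives `h ^ n` to 0.
  n*h^n≤1 : ∀ n → n ×ₙ 1# * h ^ n ≤ 1#
  n*h^n≤1 zero    = ≤-resp (sym (zeroˡ _)) refl 0≤1
  n*h^n≤1 (suc n) = begin
    (1# + N) * (h * p)   ≈⟨ solve 3 (λ n h p → (con (+ 1) :+ n) :* (h :* p) := h :* (p :+ n :* p)) refl N h p ⟩
    h * (p + N * p)      ≤⟨ *-monoʳ-≤ 0≤h (+-mono-≤ (h^n≤1 n) (n*h^n≤1 n)) ⟩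
    h * (1# + 1#)        ≈⟨ trans (*-comm _ _) 2h≈1 ⟩
    1#                   ∎
    where
    N = n ×ₙ 1#
    p = h ^ n

    h^n≤1 : ∀ n → h ^ n ≤ 1#
    h^n≤1 zero    = ≤-refl
    h^n≤1 (suc n) = ≤-trans (*-monoʳ-≤ 0≤h (h^n≤1 n)) (≤-resp (sym (*-identityʳ h)) refl (inj₁ h<1))

  Ah^n⟶0 : ∀ A ε → 0# < ε → ∃[ N ] (∀ n → N ℕ.≤ n → A * h ^ n < ε)
  -- From some N on, n exceeds A/ε; then A hⁿ < ε (n hⁿ), and the last factor is at most 1.
  Ah^n⟶0 A ε 0<ε with archimedean (A * ε ⁻¹)
  ... | N , p = N , λ n N≤n → begin-strict
    A * h ^ n                        ≈⟨ *-congʳ (trans (sym (*-identityʳ A)) (*-congˡ (sym ε⁻¹))) ⟩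
    A * (ε * ε ⁻¹) * h ^ n           ≈⟨ solve 4 (λ a e f p → a :* (e :* f) :* p := (a :* f) :* (e :* p)) refl _ _ _ _ ⟩
    (A * ε ⁻¹) * (ε * h ^ n)         <⟨ *-monoˡ-< (*-pos 0<ε (^-pos n 0<h)) (<-≤-trans p (×ₙ-mono N≤n)) ⟩
    (n ×ₙ 1#) * (ε * h ^ n)          ≈⟨ solve 3 (λ n e p → n :* (e :* p) := e :* (n :* p)) refl _ _ _ ⟩
    ε * (n ×ₙ 1# * h ^ n)            ≤⟨ *-monoʳ-≤ (inj₁ 0<ε) (n*h^n≤1 n) ⟩
    ε * 1#                           ≈⟨ *-identityʳ ε ⟩
    ε                                ∎
    where
    ε⁻¹ : ε * ε ⁻¹ ≈ 1#
    ε⁻¹ = *-inverse (>⇒≉ 0<ε)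

  monotone : (f : ℕ → Carrier) → (∀ n → f n ≤ f (suc n)) → ∀ {m n} → m ℕ.≤ n → f m ≤ f n
  monotone f step m≤n = go (ℕ.≤⇒≤′ m≤n)
    where
    go : ∀ {m n} → m ℕ.≤′ n → f m ≤ f n
    go ℕ.≤′-refl     = ≤-refl
    go (ℕ.≤′-step p) = ≤-trans (go p) (step _)

  infix 10 ∣_∣
  ∣_∣ : Carrier → Carrier
  ∣ x ∣ with ≤-or-> 0# x
  ... | inj₁ _ = x
  ... | inj₂ _ = - x

  ∣∣-cases : ∀ x → ∣ x ∣ ≈ x ⊎ ∣ x ∣ ≈ - x
  ∣∣-cases x with ≤-or-> 0# x
  ... | inj₁ _ = inj₁ refl
  ... | inj₂ _ = inj₂ refl

  ∣∣-least : ∀ {x b} → x ≤ b → - x ≤ b → ∣ x ∣ ≤ b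
  ∣∣-least {x} p q with ≤-or-> 0# x
  ... | inj₁ _ = p
  ... | inj₂ _ = q

  ∣∣-least-< : ∀ {x b} → x < b → - x < b → ∣ x ∣ < b
  ∣∣-least-< {x} p q with ≤-or-> 0# x
  ... | inj₁ _ = p
  ... | inj₂ _ = q

  0≤∣∣ : ∀ x → 0# ≤ ∣ x ∣
  0≤∣∣ x with ≤-or-> 0# x
  ... | inj₁ p = p
  ... | inj₂ p = inj₁ (<-resp -0≈0 refl (-‿mono-< p))

  private
    0≤x⇒-x≤x : ∀ {x} → 0# ≤ x → - x ≤ x
    0≤x⇒-x≤x p = ≤-trans (≤-resp refl -0≈0 (-‿mono-≤ p)) p

    -‿involutive : ∀ x → - - x ≈ x
    -‿involutive = solve 1 (λ x → :- :- x := x) refl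

  x≤∣x∣ : ∀ x → x ≤ ∣ x ∣
  x≤∣x∣ x with ∣∣-cases x
  ... | inj₁ p = inj₂ (sym p)
  ... | inj₂ p = ≤-resp (trans (-‿cong p) (-‿involutive x)) refl (0≤x⇒-x≤x (0≤∣∣ x))

  -x≤∣x∣ : ∀ x → - x ≤ ∣ x ∣
  -x≤∣x∣ x with ∣∣-cases x
  ... | inj₁ p = ≤-resp (-‿cong p) refl (0≤x⇒-x≤x (0≤∣∣ x))
  ... | inj₂ p = inj₂ (sym p)

  ∣∣-cong-≤ : ∀ {x y} → x ≈ y → ∣ x ∣ ≤ ∣ y ∣
  ∣∣-cong-≤ {x} {y} p = ∣∣-least (≤-resp (sym p) refl (x≤∣x∣ y)) (≤-resp (-‿cong (sym p)) refl (-x≤∣x∣ y))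

  ∣∣-+ : ∀ x y → ∣ x + y ∣ ≤ ∣ x ∣ + ∣ y ∣
  ∣∣-+ x y = ∣∣-least (+-mono-≤ (x≤∣x∣ x) (x≤∣x∣ y))
    (≤-resp (solve 2 (λ x y → :- x :+ :- y := :- (x :+ y)) refl x y) refl
      (+-mono-≤ (-x≤∣x∣ x) (-x≤∣x∣ y)))

  ∣∣-neg : ∀ x → ∣ - x ∣ ≤ ∣ x ∣
  ∣∣-neg x = ∣∣-least (-x≤∣x∣ x) (≤-resp (sym (-‿involutive x)) refl (x≤∣x∣ x))

  private
    ±⇒≤ : ∀ {x p} → 0# ≤ p → p ≈ x ⊎ p ≈ - x → ∣ x ∣ ≤ p
    ±⇒≤ 0≤p (inj₁ q) = ∣∣-least (inj₂ (sym q)) (≤-resp (-‿cong q) refl (0≤x⇒-x≤x 0≤p))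
    ±⇒≤ 0≤p (inj₂ q) = ∣∣-least (≤-resp (trans (-‿cong q) (-‿involutive _)) refl (0≤x⇒-x≤x 0≤p)) (inj₂ (sym q))

  ∣∣-* : ∀ x y → ∣ x * y ∣ ≤ ∣ x ∣ * ∣ y ∣
  ∣∣-* x y = ±⇒≤ (0≤* (0≤∣∣ x) (0≤∣∣ y)) sign
    where
    sign : ∣ x ∣ * ∣ y ∣ ≈ x * y ⊎ ∣ x ∣ * ∣ y ∣ ≈ - (x * y)
    sign with ∣∣-cases x | ∣∣-cases y
    ... | inj₁ p | inj₁ q = inj₁ (*-cong p q)
    ... | inj₁ p | inj₂ q = inj₂ (trans (*-cong p q) (solve 2 (λ x y → x :* :- y := :- (x :* y)) refl x y))
    ... | inj₂ p | inj₁ q = inj₂ (trans (*-cong p q) (solve 2 (λ x y → :- x :* y := :- (x :* y)) refl x y))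
    ... | inj₂ p | inj₂ q = inj₁ (trans (*-cong p q) (solve 2 (λ x y → :- x :* :- y := x :* y) refl x y))

  ∣x∣²≤x² : ∀ x → ∣ x ∣ * ∣ x ∣ ≤ x * x
  ∣x∣²≤x² x with ∣∣-cases x
  ... | inj₁ p = inj₂ (*-cong p p)
  ... | inj₂ p = inj₂ (trans (*-cong p p) (solve 1 (λ x → :- x :* :- x := x :* x) refl x))

  x²≤∣x∣² : ∀ x → x * x ≤ ∣ x ∣ * ∣ x ∣
  x²≤∣x∣² x with ∣∣-cases x
  ... | inj₁ p = inj₂ (sym (*-cong p p))
  ... | inj₂ p = inj₂ (sym (trans (*-cong p p) (solve 1 (λ x → :- x :* :- x := x :* x) refl x)))

  x²<y²⇒x<y : ∀ {x y} → 0# ≤ y → x * x < y * y → x < y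
  x²<y²⇒x<y {x} {y} 0≤y p with ≤-or-> y x
  ... | inj₂ q = q
  ... | inj₁ q = ⊥-elim (<⇒≱ p (*-mono-≤ 0≤y (≤-trans 0≤y q) q q))

  -- u ± (2A)hⁿ is monotone, so the tail of u from N on oscillates by at most (4A)hᴺ.
  geometric-limit : ∀ u A → (∀ n → ∣ u (suc n) - u n ∣ ≤ A * h ^ n) → ∃[ l ] IsLimit u l
  geometric-limit u A step = complete u cauchy
    where
    B : ℕ → Carrier
    B n = (A + A) * h ^ n

    B-step : ∀ n → B n ≈ B (suc n) + A * h ^ n
    B-step n = trans (h^-halves (A + A) n) (+-congˡ (sym (trans (h^-halves A n)
      (solve 2 (λ a p → a :* p :+ a :* p := (a :+ a) :* p) refl A (h ^ suc n)))))

    up : ∀ n → u n - B n ≤ u (suc n) - B (suc n)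
    up n = 0≤y-x⇒x≤y (≤-resp refl
      (trans (solve 4 (λ p b v w → p :- :- (w :- v) := (w :- b) :- (v :- (b :+ p))) refl (A * h ^ n) (B (suc n)) (u n) (u (suc n)))
             (+-congˡ (-‿cong (+-congˡ (-‿cong (sym (B-step n)))))))
      (x≤y⇒0≤y-x (≤-trans (-x≤∣x∣ _) (step n))))

    down : ∀ n → - (u n + B n) ≤ - (u (suc n) + B (suc n))
    down n = 0≤y-x⇒x≤y (≤-resp refl
      (trans (solve 4 (λ p b v w → p :- (w :- v) := :- (w :+ b) :- :- (v :+ (b :+ p))) refl (A * h ^ n) (B (suc n)) (u n) (u (suc n)))
             (+-congˡ (-‿cong (-‿cong (+-congˡ (sym (B-step n)))))))
      (x≤y⇒0≤y-x (≤-trans (x≤∣x∣ _) (step n))))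

    0≤B : ∀ n → 0# ≤ B n
    0≤B n = ≤-resp refl (solve 2 (λ a p → a :* p :+ a :* p := (a :+ a) :* p) refl A (h ^ n))
      (≤-resp (+-identityˡ 0#) refl (+-mono-≤ 0≤A 0≤A))
      where
      0≤A : 0# ≤ A * h ^ n
      0≤A = ≤-trans (0≤∣∣ _) (step n)

    oscillation : ∀ N m n → N ℕ.≤ m → N ℕ.≤ n → u m - u n ≤ (A + A + (A + A)) * h ^ N
    oscillation N m n N≤m N≤n = begin
      u m - u n                                  ≤⟨ +-mono-≤ (x≤x+y (0≤B m)) (x≤x+y (0≤B n)) ⟩
      (u m + B m) + (- u n + B n)                ≈⟨ solve 4 (λ a b c d → (a :+ b) :+ (:- c :+ d) := :- (:- (a :+ b)) :+ :- (c :- d)) refl _ _ _ _ ⟩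
      - (- (u m + B m)) + - (u n - B n)          ≤⟨ +-mono-≤ (-‿mono-≤ (monotone (λ n → - (u n + B n)) down N≤m))
                                                            (-‿mono-≤ (monotone (λ n → u n - B n) up N≤n)) ⟩
      - (- (u N + B N)) + - (u N - B N)          ≈⟨ solve 3 (λ v a p → :- (:- (v :+ (a :+ a) :* p)) :+ :- (v :- (a :+ a) :* p)
                                                      := (a :+ a :+ (a :+ a)) :* p) refl (u N) A (h ^ N) ⟩
      (A + A + (A + A)) * h ^ N                  ∎

    cauchy : IsCauchy u
    cauchy ε 0<ε = let N , p = Ah^n⟶0 (A + A + (A + A)) ε 0<ε in
      N , λ m n N≤m N≤n → ≤-<-trans (oscillation N m n N≤m N≤n) (p N ℕ.≤-refl)

-- Partial sums and convergence of power series over a normed ring.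

module PartialSums {c ℓ} (R : CommutativeRing c ℓ) where

  open CommutativeRing R
  open RawSemiringDefinitions (Semiring.rawSemiring semiring) using (_^_)
  open CommutativeMonoidSum +-commutativeMonoid using (sum; sum-cong-≋; sum-replicate-zero; ∑-distrib-+)
  open SemiringSum semiring using (*-distribˡ-sum)
  open IntegerCoefficients R
  open FormalSubstitution R
  open import Relation.Binary.Reasoning.Setoid setoid

  P : Seq → Carrier → Seq
  P c z M = sum {M} (λ i → c (toℕ i) * z ^ toℕ i)

  P-cong : ∀ {c d} z → c ≋ d → P c z ≋ P d z
  P-cong z p M = sum-cong-≋ {M} (λ i → *-congʳ (p (toℕ i)))

  P-0 : ∀ z → P 0ˢ z ≋ 0ˢ
  P-0 z M = trans (sum-cong-≋ {M} (λ i → zeroˡ _)) (sum-replicate-zero M)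

  P-+ : ∀ c d z → P (c +ˢ d) z ≋ P c z +ˢ P d z
  P-+ c d z M = trans
    (sum-cong-≋ {M} (λ i → distribʳ _ _ _))
    (∑-distrib-+ {M} (λ i → c (toℕ i) * z ^ toℕ i) (λ i → d (toℕ i) * z ^ toℕ i))

  P-* : ∀ a c z → P (a *ˢ c) z ≋ a *ˢ P c z
  P-* a c z M = trans
    (sum-cong-≋ {M} (λ i → *-assoc _ _ _))
    (sym (*-distribˡ-sum {M} a (λ i → c (toℕ i) * z ^ toℕ i)))

  P-cons : ∀ c z M → P c z (suc M) ≈ c 0 + z * P (tail c) z M
  P-cons c z M = +-cong (*-identityʳ _) (begin
    sum {M} (λ i → c (suc (toℕ i)) * (z * z ^ toℕ i))
      ≈⟨ sum-cong-≋ {M} (λ i → solve 3 (λ a z p → a :* (z :* p) := z :* (a :* p)) refl _ _ _) ⟩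
    sum {M} (λ i → z * (c (suc (toℕ i)) * z ^ toℕ i))
      ≈⟨ *-distribˡ-sum {M} z (λ i → c (suc (toℕ i)) * z ^ toℕ i) ⟨
    z * P (tail c) z M ∎)

  -- The sum unfolds at its first term, so the last one is split off by induction through the tail.
  P-snoc : ∀ c z M → P c z (suc M) ≈ P c z M + c M * z ^ M
  P-snoc c z zero    = +-comm _ _
  P-snoc c z (suc M) = begin
    P c z (suc (suc M))                                ≈⟨ P-cons c z (suc M) ⟩
    c 0 + z * P (tail c) z (suc M)                     ≈⟨ +-congˡ (*-congˡ (P-snoc (tail c) z M)) ⟩
    c 0 + z * (P (tail c) z M + c (suc M) * z ^ M)     ≈⟨ solve 5 (λ a z q b p → a :+ z :* (q :+ b :* p) := (a :+ z :* q) :+ b :* (z :* p)) refl _ _ _ _ _ ⟩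
    c 0 + z * P (tail c) z M + c (suc M) * z ^ suc M   ≈⟨ +-congʳ (P-cons c z M) ⟨
    P c z (suc M) + c (suc M) * z ^ suc M              ∎

-- The norm is only submultiplicative, which admits the ℓ¹ norm on the complex numbers. Completeness
-- is stated for steps of order 2⁻ⁿ, the form in which partial sums of power series occur here; over
-- the complex numbers it then follows coordinatewise.
record CompleteNorm {a ℓ₁ ℓ₂ c ℓ} (ℝ : CompleteOrderedField a ℓ₁ ℓ₂)
                    (C : CommutativeRing c ℓ) : Set (a ⊔ ℓ₁ ⊔ ℓ₂ ⊔ c ⊔ ℓ) where
  private
    module R = CompleteOrderedField ℝ
    module C = CommutativeRing C
  open OrderedField ℝ using (_≤_; h)

  field
    ‖_‖      : C.Carrier → R.Carrier
    ‖‖-cong≤ : ∀ {z w} → z C.≈ w → ‖ z ‖ ≤ ‖ w ‖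
    0≤‖‖     : ∀ z → R.0# ≤ ‖ z ‖
    ‖0‖≤0    : ‖ C.0# ‖ ≤ R.0#
    ‖‖≤0⇒≈0  : ∀ {z} → ‖ z ‖ ≤ R.0# → z C.≈ C.0#
    ‖1‖≤1    : ‖ C.1# ‖ ≤ R.1#
    ‖‖-+     : ∀ z w → ‖ z C.+ w ‖ ≤ ‖ z ‖ R.+ ‖ w ‖
    ‖‖-*     : ∀ z w → ‖ z C.* w ‖ ≤ ‖ z ‖ R.* ‖ w ‖
    ‖‖-neg   : ∀ z → ‖ C.- z ‖ ≤ ‖ z ‖

  infix 4 _⟶_
  _⟶_ : (ℕ → C.Carrier) → C.Carrier → Set (a ⊔ ℓ₂)
  s ⟶ l = ∀ ε → R.0# R.< ε → ∃[ N ] (∀ n → N ℕ.≤ n → ‖ s n C.- l ‖ R.< ε)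

  field
    geometric-limit : ∀ s A → (∀ n → ‖ s (suc n) C.- s n ‖ ≤ A R.* h R.^ n) → ∃[ l ] s ⟶ l

module PowerSeries {a ℓ₁ ℓ₂ c ℓ} (ℝ : CompleteOrderedField a ℓ₁ ℓ₂)
                   (C : CommutativeRing c ℓ) (norm : CompleteNorm ℝ C) where

  open CompleteOrderedField ℝ
  open OrderedField ℝ hiding (geometric-limit)
  private
    module C = CommutativeRing C
    module ℝ-Solver = IntegerCoefficients commutativeRing
    module C-Solver = IntegerCoefficients C
  open C using () renaming (_+_ to _+ᶜ_; _*_ to _*ᶜ_; -_ to -ᶜ_; _-_ to _-ᶜ_; _≈_ to _≈ᶜ_)
  open RawSemiringDefinitions (Semiring.rawSemiring C.semiring) using () renaming (_^_ to _^ᶜ_)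
  open CompleteNorm norm
  open FormalSubstitution C
  open PartialSums C
  open ≤-Reasoning

  ‖‖-- : ∀ z w → ‖ z -ᶜ w ‖ ≤ ‖ z ‖ + ‖ w ‖
  ‖‖-- z w = ≤-trans (‖‖-+ z (-ᶜ w)) (+-mono-≤ ≤-refl (‖‖-neg w))

  ‖‖-^ : ∀ z n → ‖ z ^ᶜ n ‖ ≤ ‖ z ‖ ^ n
  ‖‖-^ z zero    = ‖1‖≤1
  ‖‖-^ z (suc n) = ≤-trans (‖‖-* z _) (*-monoʳ-≤ (0≤‖‖ z) (‖‖-^ z n))

  ⟶-cong : ∀ {s t l} → s ≋ t → s ⟶ l → t ⟶ l
  ⟶-cong p s⟶l ε 0<ε with s⟶l ε 0<ε
  ... | N , q = N , λ n N≤n → ≤-<-trans (‖‖-cong≤ (C.+-congʳ (C.sym (p n)))) (q n N≤n)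

  ⟶-const : ∀ l → (λ _ → l) ⟶ l
  ⟶-const l ε 0<ε = 0 , λ n _ → ≤-<-trans (≤-trans (‖‖-cong≤ (C.-‿inverseʳ l)) ‖0‖≤0) 0<ε

  private
    half-pos : ∀ {ε} → 0# < ε → 0# < h * ε
    half-pos = *-pos 0<h

  ⟶-+ : ∀ {s t l m} → s ⟶ l → t ⟶ m → s +ˢ t ⟶ l +ᶜ m
  ⟶-+ {s} {t} {l} {m} p q ε 0<ε with p (h * ε) (half-pos 0<ε) | q (h * ε) (half-pos 0<ε)
  ... | M , p′ | N , q′ = M ℕ.⊔ N , λ n M⊔N≤n → begin-strict
    ‖ (s n +ᶜ t n) -ᶜ (l +ᶜ m) ‖        ≤⟨ ‖‖-cong≤ (C-Solver.solve 4 (λ s t l m → (s :+ t) :- (l :+ m) := (s :- l) :+ (t :- m)) C.refl _ _ _ _) ⟩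
    ‖ (s n -ᶜ l) +ᶜ (t n -ᶜ m) ‖        ≤⟨ ‖‖-+ _ _ ⟩
    ‖ s n -ᶜ l ‖ + ‖ t n -ᶜ m ‖         <⟨ +-mono-< (p′ n (ℕ.≤-trans (ℕ.m≤m⊔n M N) M⊔N≤n)) (q′ n (ℕ.≤-trans (ℕ.m≤n⊔m M N) M⊔N≤n)) ⟩
    h * ε + h * ε                       ≈⟨ halves ε ⟩
    ε                                   ∎
    where open C-Solver

  ⟶-* : ∀ b {s l} → s ⟶ l → b *ˢ s ⟶ b *ᶜ l
  ⟶-* b {s} {l} p ε 0<ε = let N , p′ = p (ε * B ⁻¹) (*-pos 0<ε (⁻¹-pos 0<B)) in
    N , λ n N≤n → begin-strict
    ‖ b *ᶜ s n -ᶜ b *ᶜ l ‖   ≤⟨ ‖‖-cong≤ (C-Solver.solve 3 (λ b s l → b :*ᶜ s :-ᶜ b :*ᶜ l :=ᶜ b :*ᶜ (s :-ᶜ l)) C.refl _ _ _) ⟩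
    ‖ b *ᶜ (s n -ᶜ l) ‖      ≤⟨ ‖‖-* _ _ ⟩
    ‖ b ‖ * ‖ s n -ᶜ l ‖     ≤⟨ *-monoˡ-≤ (0≤‖‖ _) (x≤x+y 0≤1) ⟩
    B * ‖ s n -ᶜ l ‖         <⟨ *-monoʳ-< 0<B (p′ n N≤n) ⟩
    B * (ε * B ⁻¹)           ≈⟨ solve 3 (λ b e i → b :* (e :* i) := e :* (b :* i)) refl _ _ _ ⟩
    ε * (B * B ⁻¹)           ≈⟨ *-congˡ (*-inverse (>⇒≉ 0<B)) ⟩
    ε * 1#                   ≈⟨ *-identityʳ ε ⟩
    ε                        ∎
    where
    open ℝ-Solver
    open C-Solver using () renaming (_:*_ to _:*ᶜ_; _:-_ to _:-ᶜ_; _:=_ to _:=ᶜ_)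

    -- Adding 1 keeps the divisor positive when `b` is zero.
    B : Carrier
    B = ‖ b ‖ + 1#

    0<B : 0# < B
    0<B = <-≤-trans 0<1 (y≤x+y (0≤‖‖ b))

  ⟶-unique : ∀ {s l m} → s ⟶ l → s ⟶ m → l ≈ᶜ m
  ⟶-unique {s} {l} {m} p q with ≤-or-> ‖ l -ᶜ m ‖ 0#
  ... | inj₁ r = C.trans (C-Solver.solve 2 (λ l m → l := (l :- m) :+ m) C.refl l m)
                   (C.trans (C.+-congʳ (‖‖≤0⇒≈0 r)) (C.+-identityˡ m))
    where open C-Solver
  ... | inj₂ r with p (h * ‖ l -ᶜ m ‖) (half-pos r) | q (h * ‖ l -ᶜ m ‖) (half-pos r)
  ...   | M , p′ | N , q′ = ⊥-elim (<-irrefl refl (begin-strict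
    ‖ l -ᶜ m ‖                            ≤⟨ ‖‖-cong≤ (C-Solver.solve 3 (λ s l m → l :- m := (s :- m) :- (s :- l)) C.refl (s n) l m) ⟩
    ‖ (s n -ᶜ m) -ᶜ (s n -ᶜ l) ‖          ≤⟨ ‖‖-- _ _ ⟩
    ‖ s n -ᶜ m ‖ + ‖ s n -ᶜ l ‖           <⟨ +-mono-< (q′ n (ℕ.m≤n⊔m M N)) (p′ n (ℕ.m≤m⊔n M N)) ⟩
    h * ‖ l -ᶜ m ‖ + h * ‖ l -ᶜ m ‖       ≈⟨ halves _ ⟩
    ‖ l -ᶜ m ‖                            ∎))
    where
    open C-Solver

    n : ℕ
    n = M ℕ.⊔ N

  ⟶-perturb : ∀ {s t l} A → (∀ n → ‖ s n -ᶜ t n ‖ ≤ A * h ^ n) → s ⟶ l → t ⟶ l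
  ⟶-perturb {s} {t} {l} A b p ε 0<ε =
    let M , p′ = p (h * ε) (half-pos 0<ε)
        N , q′ = Ah^n⟶0 A (h * ε) (half-pos 0<ε)
    in M ℕ.⊔ N , λ n M⊔N≤n → begin-strict
    ‖ t n -ᶜ l ‖                        ≤⟨ ‖‖-cong≤ (solve 3 (λ s t l → t :- l := (s :- l) :- (s :- t)) C.refl (s n) (t n) l) ⟩
    ‖ (s n -ᶜ l) -ᶜ (s n -ᶜ t n) ‖      ≤⟨ ‖‖-- _ _ ⟩
    ‖ s n -ᶜ l ‖ + ‖ s n -ᶜ t n ‖       <⟨ +-mono-< (p′ n (ℕ.≤-trans (ℕ.m≤m⊔n M N) M⊔N≤n))
                                            (≤-<-trans (b n) (q′ n (ℕ.≤-trans (ℕ.m≤n⊔m M N) M⊔N≤n))) ⟩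
    h * ε + h * ε                       ≈⟨ halves ε ⟩
    ε                                   ∎
    where open C-Solver

  GeometricBound : Carrier → Carrier → Seq → Set _
  GeometricBound A K c = ∀ n → ‖ c n ‖ ≤ A * K ^ n

  term-bound : ∀ {A K c z} → 0# ≤ A → 0# ≤ K → GeometricBound A K c → K * ‖ z ‖ ≤ h →
               ∀ n → ‖ c n *ᶜ z ^ᶜ n ‖ ≤ A * h ^ n
  term-bound {A} {K} {c} {z} 0≤A 0≤K b Kz≤h n = begin
    ‖ c n *ᶜ z ^ᶜ n ‖            ≤⟨ ‖‖-* _ _ ⟩
    ‖ c n ‖ * ‖ z ^ᶜ n ‖         ≤⟨ *-mono-≤ (0≤‖‖ _) (0≤* 0≤A (0≤^ n 0≤K)) (b n) (‖‖-^ z n) ⟩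
    A * K ^ n * ‖ z ‖ ^ n        ≈⟨ *-assoc _ _ _ ⟩
    A * (K ^ n * ‖ z ‖ ^ n)      ≤⟨ *-monoʳ-≤ 0≤A (powers n) ⟩
    A * h ^ n                    ∎
    where
    open ℝ-Solver
    powers : ∀ n → K ^ n * ‖ z ‖ ^ n ≤ h ^ n
    powers zero    = inj₂ (*-identityˡ _)
    powers (suc n) = begin
      K * K ^ n * (‖ z ‖ * ‖ z ‖ ^ n)   ≈⟨ solve 4 (λ a b c d → a :* b :* (c :* d) := (a :* c) :* (b :* d)) refl _ _ _ _ ⟩
      K * ‖ z ‖ * (K ^ n * ‖ z ‖ ^ n)   ≤⟨ *-mono-≤ (0≤* (0≤^ n 0≤K) (0≤^ n (0≤‖‖ z))) 0≤h Kz≤h (powers n) ⟩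
      h * h ^ n                         ∎

  series-converges : ∀ {A K c z} → 0# ≤ A → 0# ≤ K → GeometricBound A K c → K * ‖ z ‖ ≤ h →
                     ∃[ l ] P c z ⟶ l
  series-converges {A} {K} {c} {z} 0≤A 0≤K b Kz≤h = geometric-limit (P c z) A λ n → begin
    ‖ P c z (suc n) -ᶜ P c z n ‖                   ≤⟨ ‖‖-cong≤ (C.+-congʳ (P-snoc c z n)) ⟩
    ‖ (P c z n +ᶜ c n *ᶜ z ^ᶜ n) -ᶜ P c z n ‖      ≤⟨ ‖‖-cong≤ (solve 2 (λ p t → p :+ t :- p := t) C.refl _ _) ⟩
    ‖ c n *ᶜ z ^ᶜ n ‖                              ≤⟨ term-bound 0≤A 0≤K b Kz≤h n ⟩
    A * h ^ n                                      ∎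
    where open C-Solver

  -- The hypothesis on u says u = z/(z-1).  The partial sums at z and at u differ by
  -- a remainder that inherits the recursion of T and U, so it is bounded without
  -- rearranging a double series.
  module Substitution {z u : C.Carrier} {K : Carrier} (u≈zu-z : u ≈ᶜ z *ᶜ u -ᶜ z)
                      (1≤K : 1# ≤ K) (Ku≤h : K * ‖ u ‖ ≤ h)
                      (4Kz≤h : (1# + 1# + (1# + 1#)) * K * ‖ z ‖ ≤ h) where

    private
      0≤K : 0# ≤ K
      0≤K = ≤-trans 0≤1 1≤K

      -- The remainders for uF(u) and F(u). They do not vanish: cutting off at degree N in u and at
      -- degree N in z leaves different polynomials.
      V W : Seq → Seq
      V d N = P (shift d) u N -ᶜ P (U d) z N
      W c N = P c u N -ᶜ P (T c) z N

      -- Replacing a factor u by zu - z reproduces the recursion of `U` on partial sums. The extra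
      -- term appears because u times a partial sum of length N is one of length N + 1.
      V-suc : ∀ d N → V d (suc N) ≈ᶜ z *ᶜ (V d N -ᶜ W d N +ᶜ shift d N *ᶜ u ^ᶜ N)
      V-suc d N = let open C-Solver in
        C.trans (C.+-cong (P-cons (shift d) u N) (C.-‿cong (P-cons (U d) z N)))
       (C.trans (C.+-cong (C.+-congˡ (C.*-congʳ u≈zu-z)) (C.-‿cong (C.+-congˡ (C.*-congˡ tail-U))))
       (C.trans (solve 5 (λ z u p q r → (con (+ 0) :+ (z :* u :- z) :* p) :- (con (+ 0) :+ z :* (q :+ :- con (+ 1) :* r))
                                     := z :* ((con (+ 0) :+ u :* p) :- q :- (p :- r))) C.refl _ _ _ _ _)
       (C.trans (C.*-congˡ (C.+-congʳ (C.+-congʳ (C.trans (C.sym (P-cons (shift d) u N)) (P-snoc (shift d) u N)))))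
                (C.*-congˡ (solve 4 (λ s t q w → s :+ t :- q :- w := (s :- q) :- w :+ t) C.refl _ _ _ _)))))
        where
        tail-U : P (tail (U d)) z N ≈ᶜ P (U d) z N +ᶜ (-ᶜ C.1#) *ᶜ P (T d) z N
        tail-U = let open C-Solver in
          C.trans (P-cong z (λ n → solve 2 (λ a b → a :- b := a :+ :- con (+ 1) :* b) C.refl (U d n) (T d n)) N)
         (C.trans (P-+ (U d) ((-ᶜ C.1#) *ˢ T d) z N)
                  (C.+-congˡ (P-* (-ᶜ C.1#) (T d) z N)))

      W-suc : ∀ c N → W c (suc N) ≈ᶜ V (tail c) (suc N)
      W-suc c N = let open C-Solver in
        C.trans (C.+-cong (P-cons c u N) (C.-‿cong (P-cons (T c) z N)))
       (C.trans (solve 3 (λ a p q → (a :+ p) :- (a :+ q) := (con (+ 0) :+ p) :- (con (+ 0) :+ q)) C.refl _ _ _)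
                (C.sym (C.+-cong (P-cons (shift (tail c)) u N) (C.-‿cong (P-cons (U (tail c)) z N)))))

      ‖0-0‖ : ∀ {x} → 0# ≤ x → ‖ C.0# -ᶜ C.0# ‖ ≤ x
      ‖0-0‖ 0≤x = ≤-trans (‖‖-cong≤ (C.-‿inverseʳ C.0#)) (≤-trans ‖0‖≤0 0≤x)

      -- Both bounds quantify over A, since passing to `tail c` replaces A by AK. In the step for V
      -- the three summands contribute A hᴺ (1 + K + 1), and (2 + K)‖z‖ ≤ 4K‖z‖ ≤ h supplies the
      -- next power of `h`. The bound for W at `suc N` rests on that for V at the same length.
      V-bound : ∀ N {A d} → 0# ≤ A → GeometricBound A K d → ‖ V d N ‖ ≤ A * h ^ N
      W-bound : ∀ N {A c} → 0# ≤ A → GeometricBound A K c → ‖ W c N ‖ ≤ A * K * h ^ N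

      V-bound zero    {A}     0≤A b = ‖0-0‖ (0≤* 0≤A 0≤1)
      V-bound (suc N) {A} {d} 0≤A b = begin
        ‖ V d (suc N) ‖                                             ≤⟨ ‖‖-cong≤ (V-suc d N) ⟩
        ‖ z *ᶜ (V d N -ᶜ W d N +ᶜ shift d N *ᶜ u ^ᶜ N) ‖            ≤⟨ ‖‖-* _ _ ⟩
        ‖ z ‖ * ‖ V d N -ᶜ W d N +ᶜ shift d N *ᶜ u ^ᶜ N ‖           ≤⟨ *-monoʳ-≤ (0≤‖‖ z) (≤-trans (‖‖-+ _ _) (+-mono-≤ (‖‖-- _ _) ≤-refl)) ⟩
        ‖ z ‖ * (‖ V d N ‖ + ‖ W d N ‖ + ‖ shift d N *ᶜ u ^ᶜ N ‖)   ≤⟨ *-monoʳ-≤ (0≤‖‖ z) (+-mono-≤ (+-mono-≤ (V-bound N 0≤A b) (W-bound N 0≤A b))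
                                                                        (term-bound 0≤A 0≤K shift-bound Ku≤h N)) ⟩
        ‖ z ‖ * (A * p + A * K * p + A * p)                         ≈⟨ solve 4 (λ z a k p → z :* (a :* p :+ a :* k :* p :+ a :* p)
                                                                        := (a :* p) :* ((con (+ 1) :+ k :+ con (+ 1)) :* z)) refl _ _ _ _ ⟩
        A * p * ((1# + K + 1#) * ‖ z ‖)                             ≤⟨ *-monoʳ-≤ 0≤Ap (*-monoˡ-≤ (0≤‖‖ z) 2+K≤4K) ⟩
        A * p * ((1# + 1# + (1# + 1#)) * K * ‖ z ‖)                 ≤⟨ *-monoʳ-≤ 0≤Ap 4Kz≤h ⟩
        A * p * h                                                   ≈⟨ solve 3 (λ a p h → a :* p :* h := a :* (h :* p)) refl _ _ _ ⟩
        A * (h * p)                                                 ∎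
        where
        open ℝ-Solver
        p = h ^ N

        0≤Ap : 0# ≤ A * p
        0≤Ap = 0≤* 0≤A (0≤^ N 0≤h)

        2+K≤4K : 1# + K + 1# ≤ (1# + 1# + (1# + 1#)) * K
        2+K≤4K = begin
          1# + K + 1#         ≤⟨ +-mono-≤ (+-mono-≤ 1≤K ≤-refl) 1≤K ⟩
          K + K + K           ≤⟨ x≤x+y 0≤K ⟩
          K + K + K + K       ≈⟨ solve 1 (λ k → k :+ k :+ k :+ k := (con (+ 1) :+ con (+ 1) :+ (con (+ 1) :+ con (+ 1))) :* k) refl K ⟩
          (1# + 1# + (1# + 1#)) * K ∎

        shift-bound : GeometricBound A K (shift d)
        shift-bound zero    = ≤-trans ‖0‖≤0 (0≤* 0≤A 0≤1)
        shift-bound (suc n) = ≤-trans (b n) (*-monoʳ-≤ 0≤A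
          (≤-resp (*-identityˡ _) refl (*-monoˡ-≤ (0≤^ n 0≤K) 1≤K)))

      W-bound zero            0≤A b = ‖0-0‖ (0≤* (0≤* 0≤A 0≤K) 0≤1)
      W-bound (suc N) {c = c} 0≤A b = ≤-trans (‖‖-cong≤ (W-suc c N))
        (V-bound (suc N) (0≤* 0≤A 0≤K) (λ n → ≤-trans (b (suc n)) (inj₂ (sym (*-assoc _ _ _)))))

    substitution : ∀ {A c l} → 0# ≤ A → GeometricBound A K c → P c u ⟶ l → P (T c) z ⟶ l
    substitution {A} 0≤A b = ⟶-perturb (A * K) (λ n → W-bound n 0≤A b)

    substitution-unique : ∀ {A} c d l m → 0# ≤ A → GeometricBound A K c → T c ≋ d →
                          P c u ⟶ l → P d z ⟶ m → l ≈ᶜ m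
    substitution-unique c d l m 0≤A b p c⟶l d⟶m =
      ⟶-unique (⟶-cong (P-cong z p) (substitution 0≤A b c⟶l)) d⟶m

-- The embedding of the rationals is multiplicative.

module RationalEmbedding {c ℓ₁ ℓ₂} (ℝ : CompleteOrderedField c ℓ₁ ℓ₂) where

  open CompleteOrderedField ℝ
  open OrderedField ℝ using (<-≤-trans; 1≤suc; >⇒≉; *-inverse)
  open IntegerCoefficients commutativeRing
  open MultOptimised semiring using (×ᵤ≈×)
  open import Relation.Binary.Reasoning.Setoid setoid

  fromℤ≈⟦⟧ : ∀ i → fromℤ i ≈ ⟦ i ⟧ᶻ
  fromℤ≈⟦⟧ (+ n)    = ×ᵤ≈× n 1#
  fromℤ≈⟦⟧ -[1+ n ] = -‿cong (×ᵤ≈× (suc n) 1#)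

  fromℤ-* : ∀ i j → fromℤ (i ℤ.* j) ≈ fromℤ i * fromℤ j
  fromℤ-* i j = begin
    fromℤ (i ℤ.* j)    ≈⟨ fromℤ≈⟦⟧ (i ℤ.* j) ⟩
    ⟦ i ℤ.* j ⟧ᶻ       ≈⟨ ⟦*⟧ᶻ i j ⟩
    ⟦ i ⟧ᶻ * ⟦ j ⟧ᶻ    ≈⟨ *-cong (fromℤ≈⟦⟧ i) (fromℤ≈⟦⟧ j) ⟨
    fromℤ i * fromℤ j  ∎

  suc-inverse : ∀ n → suc n ×ₙ 1# * (suc n ×ₙ 1#) ⁻¹ ≈ 1#
  suc-inverse n = *-inverse (>⇒≉ (<-≤-trans 0<1 (1≤suc n)))

  ↧-inverse : ∀ q → fromℤ (↧ q) * (↧ₙ q ×ₙ 1#) ⁻¹ ≈ 1#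
  ↧-inverse (mkℚ _ d _) = suc-inverse d

  cross-* : ∀ p q → ↥ (p ℚ.* q) ℤ.* (↧ p ℤ.* ↧ q) ≡ (↥ p ℤ.* ↥ q) ℤ.* ↧ (p ℚ.* q)
  cross-* p q = cross (p ℚ.* q) p q (ℚ.toℚᵘ-homo-* p q)
    where
    cross : ∀ r p q → ℚ.toℚᵘ r ℚᵘ.≃ ℚ.toℚᵘ p ℚᵘ.* ℚ.toℚᵘ q →
            ↥ r ℤ.* (↧ p ℤ.* ↧ q) ≡ (↥ p ℤ.* ↥ q) ℤ.* ↧ r
    cross (mkℚ _ _ _) (mkℚ _ _ _) (mkℚ _ _ _) = ℚᵘ.drop-*≡*

  -- A product in lowest terms may have lost a common factor, so numerators and denominators do not
  -- multiply separately. Inserting b₁i₁ = b₂i₂ = 1 brings in the old denominators, after which the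
  -- cross-multiplied equation applies.
  fromℚ-* : ∀ p q → fromℚ (p ℚ.* q) ≈ fromℚ p * fromℚ q
  fromℚ-* p q = begin
    a * i                                   ≈⟨ solve 2 (λ a i → a :* i := a :* i :* (con (+ 1) :* con (+ 1))) refl a i ⟩
    a * i * (1# * 1#)                       ≈⟨ *-congˡ (*-cong (↧-inverse p) (↧-inverse q)) ⟨
    a * i * ((b₁ * i₁) * (b₂ * i₂))         ≈⟨ solve 6 (λ a i b₁ i₁ b₂ i₂ → a :* i :* ((b₁ :* i₁) :* (b₂ :* i₂)) := (a :* (b₁ :* b₂)) :* (i :* (i₁ :* i₂))) refl _ _ _ _ _ _ ⟩
    (a * (b₁ * b₂)) * (i * (i₁ * i₂))       ≈⟨ *-congʳ cross ⟩
    ((a₁ * a₂) * b) * (i * (i₁ * i₂))       ≈⟨ solve 6 (λ a₁ a₂ b i i₁ i₂ → ((a₁ :* a₂) :* b) :* (i :* (i₁ :* i₂)) := (b :* i) :* ((a₁ :* i₁) :* (a₂ :* i₂))) refl _ _ _ _ _ _ ⟩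
    (b * i) * ((a₁ * i₁) * (a₂ * i₂))       ≈⟨ *-congʳ (↧-inverse (p ℚ.* q)) ⟩
    1# * ((a₁ * i₁) * (a₂ * i₂))            ≈⟨ *-identityˡ _ ⟩
    (a₁ * i₁) * (a₂ * i₂)                   ∎
    where
    a  = fromℤ (↥ (p ℚ.* q))
    a₁ = fromℤ (↥ p)
    a₂ = fromℤ (↥ q)
    b  = fromℤ (↧ (p ℚ.* q))
    b₁ = fromℤ (↧ p)
    b₂ = fromℤ (↧ q)
    i  = (↧ₙ (p ℚ.* q) ×ₙ 1#) ⁻¹
    i₁ = (↧ₙ p ×ₙ 1#) ⁻¹
    i₂ = (↧ₙ q ×ₙ 1#) ⁻¹

    cross : a * (b₁ * b₂) ≈ (a₁ * a₂) * b
    cross = begin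
      a * (b₁ * b₂)                                ≈⟨ *-congˡ (fromℤ-* (↧ p) (↧ q)) ⟨
      a * fromℤ (↧ p ℤ.* ↧ q)                      ≈⟨ fromℤ-* (↥ (p ℚ.* q)) (↧ p ℤ.* ↧ q) ⟨
      fromℤ (↥ (p ℚ.* q) ℤ.* (↧ p ℤ.* ↧ q))        ≡⟨ ≡.cong fromℤ (cross-* p q) ⟩
      fromℤ ((↥ p ℤ.* ↥ q) ℤ.* ↧ (p ℚ.* q))        ≈⟨ fromℤ-* (↥ p ℤ.* ↥ q) (↧ (p ℚ.* q)) ⟩
      fromℤ (↥ p ℤ.* ↥ q) * b                      ≈⟨ *-congʳ (fromℤ-* (↥ p) (↥ q)) ⟩
      (a₁ * a₂) * b                                ∎

  fromℚ-0 : fromℚ 0ℚ ≈ 0#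
  fromℚ-0 = zeroˡ _

  fromℚ-1 : fromℚ 1ℚ ≈ 1#
  fromℚ-1 = suc-inverse 0

  fromℚ--1 : fromℚ (ℚ.- 1ℚ) ≈ - 1#
  fromℚ--1 = trans (solve 2 (λ a i → :- a :* i := :- (a :* i)) refl _ _) (-‿cong (suc-inverse 0))

-- The complex numbers as a field with a complete norm.

module ComplexField {c ℓ₁ ℓ₂} (ℝ : CompleteOrderedField c ℓ₁ ℓ₂) where

  open ComplexNumbers ℝ
  private
    module R = CompleteOrderedField ℝ
  open OrderedField ℝ hiding (geometric-limit)
  open IntegerCoefficients R.commutativeRing
  open RationalEmbedding ℝ using ()
    renaming (fromℚ-* to fromℚᴿ-*; fromℚ-0 to fromℚᴿ-0; fromℚ-1 to fromℚᴿ-1; fromℚ--1 to fromℚᴿ--1)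

  ℂ-commutativeRing : CommutativeRing c ℓ₁
  ℂ-commutativeRing = record
    { Carrier = ℂ
    ; _≈_ = _≈_
    ; _+_ = _+_
    ; _*_ = _*_
    ; -_ = -_
    ; 0# = 0#
    ; 1# = 1#
    ; isCommutativeRing = record
      { isRing = record
        { +-isAbelianGroup = record
          { isGroup = record
            { isMonoid = record
              { isSemigroup = record
                { isMagma = record
                  { isEquivalence = record
                    { refl  = R.refl , R.refl
                    ; sym   = λ (p , q) → R.sym p , R.sym q
                    ; trans = λ (p , q) (p′ , q′) → R.trans p p′ , R.trans q q′
                    }
                  ; ∙-cong = λ (p , q) (p′ , q′) → R.+-cong p p′ , R.+-cong q q′
                  }
                ; assoc = λ _ _ _ → R.+-assoc _ _ _ , R.+-assoc _ _ _
                }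
              ; identity = (λ _ → R.+-identityˡ _ , R.+-identityˡ _)
                         , (λ _ → R.+-identityʳ _ , R.+-identityʳ _)
              }
            ; inverse = (λ _ → R.-‿inverseˡ _ , R.-‿inverseˡ _)
                      , (λ _ → R.-‿inverseʳ _ , R.-‿inverseʳ _)
            ; ⁻¹-cong = λ (p , q) → R.-‿cong p , R.-‿cong q
            }
          ; comm = λ _ _ → R.+-comm _ _ , R.+-comm _ _
          }
        ; *-cong = λ (p , q) (p′ , q′) →
            R.+-cong (R.*-cong p p′) (R.-‿cong (R.*-cong q q′)) ,
            R.+-cong (R.*-cong p q′) (R.*-cong q p′)
        ; *-assoc = λ (a +i b) (d +i e) (f +i g) →
            solve 6 (λ a b d e f g → (a :* d :- b :* e) :* f :- (a :* e :+ b :* d) :* g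
                                   := a :* (d :* f :- e :* g) :- b :* (d :* g :+ e :* f)) R.refl a b d e f g ,
            solve 6 (λ a b d e f g → (a :* d :- b :* e) :* g :+ (a :* e :+ b :* d) :* f
                                   := a :* (d :* g :+ e :* f) :+ b :* (d :* f :- e :* g)) R.refl a b d e f g
        ; *-identity =
            (λ (a +i b) → solve 2 (λ a b → con (+ 1) :* a :- con (+ 0) :* b := a) R.refl a b
                        , solve 2 (λ a b → con (+ 1) :* b :+ con (+ 0) :* a := b) R.refl a b) ,
            (λ (a +i b) → solve 2 (λ a b → a :* con (+ 1) :- b :* con (+ 0) := a) R.refl a b
                        , solve 2 (λ a b → a :* con (+ 0) :+ b :* con (+ 1) := b) R.refl a b)
        ; distrib =
            (λ (a +i b) (d +i e) (f +i g) →
              solve 6 (λ a b d e f g → a :* (d :+ f) :- b :* (e :+ g)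
                                    := (a :* d :- b :* e) :+ (a :* f :- b :* g)) R.refl a b d e f g ,
              solve 6 (λ a b d e f g → a :* (e :+ g) :+ b :* (d :+ f)
                                    := (a :* e :+ b :* d) :+ (a :* g :+ b :* f)) R.refl a b d e f g) ,
            (λ (a +i b) (d +i e) (f +i g) →
              solve 6 (λ a b d e f g → (d :+ f) :* a :- (e :+ g) :* b
                                    := (d :* a :- e :* b) :+ (f :* a :- g :* b)) R.refl a b d e f g ,
              solve 6 (λ a b d e f g → (d :+ f) :* b :+ (e :+ g) :* a
                                    := (d :* b :+ e :* a) :+ (f :* b :+ g :* a)) R.refl a b d e f g)
        }
      ; *-comm = λ (a +i b) (d +i e) →
          solve 4 (λ a b d e → a :* d :- b :* e := d :* a :- e :* b) R.refl a b d e ,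
          solve 4 (λ a b d e → a :* e :+ b :* d := d :* b :+ e :* a) R.refl a b d e
      }
    }

  private module C = CommutativeRing ℂ-commutativeRing

  fromℚ-* : ∀ p q → fromℚ (p ℚ.* q) ≈ fromℚ p * fromℚ q
  fromℚ-* p q =
    R.trans (fromℚᴿ-* p q) (solve 2 (λ a b → a :* b := a :* b :- con (+ 0) :* con (+ 0)) R.refl _ _) ,
    solve 2 (λ a b → con (+ 0) := a :* con (+ 0) :+ con (+ 0) :* b) R.refl _ _

  fromℚ-0 : fromℚ 0ℚ ≈ 0#
  fromℚ-0 = fromℚᴿ-0 , R.refl

  fromℚ-1 : fromℚ 1ℚ ≈ 1#
  fromℚ-1 = fromℚᴿ-1 , R.refl

  fromℚ--1 : fromℚ (ℚ.- 1ℚ) ≈ - 1#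
  fromℚ--1 = fromℚᴿ--1 , R.sym -0≈0

  0≤x² : ∀ x → R.0# ≤ x R.* x
  0≤x² x = ≤-trans (0≤* (0≤∣∣ x) (0≤∣∣ x)) (∣x∣²≤x² x)

  x²≤0⇒x≈0 : ∀ {x} → x R.* x ≤ R.0# → x R.≈ R.0#
  x²≤0⇒x≈0 {x} p with R.compare x R.0#
  ... | tri≈ _ q _ = q
  ... | tri> _ _ q = ⊥-elim (<⇒≱ (R.*-pos q q) p)
  ... | tri< q _ _ = ⊥-elim (<⇒≱ (R.*-pos 0<-x 0<-x)
                       (≤-resp (solve 1 (λ x → x :* x := :- x :* :- x) R.refl x) R.refl p))
    where
    0<-x : R.0# R.< R.- x
    0<-x = <-resp -0≈0 R.refl (-‿mono-< q)

  ∣z∣²≈0⇒z≈0 : ∀ z → ∣ z ∣² R.≈ R.0# → z ≈ 0#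
  ∣z∣²≈0⇒z≈0 z p = x²≤0⇒x≈0 (≤-trans (x≤x+y (0≤x² (im z))) (inj₂ p))
                 , x²≤0⇒x≈0 (≤-trans (y≤x+y (0≤x² (re z))) (inj₂ p))

  ℂ-inverse : ∀ z → ¬ (z ≈ 0#) → z * z ⁻¹ ≈ 1#
  ℂ-inverse z z≉0 =
    R.trans (solve 3 (λ a b i → a :* (a :* i) :- b :* (:- b :* i) := (a :* a :+ b :* b) :* i) R.refl (re z) (im z) (∣ z ∣² R.⁻¹))
            (*-inverse (λ p → z≉0 (∣z∣²≈0⇒z≈0 z p))) ,
    solve 3 (λ a b i → a :* (:- b :* i) :+ b :* (a :* i) := con (+ 0)) R.refl (re z) (im z) (∣ z ∣² R.⁻¹)

  1≉0 : ¬ (1# ≈ 0#)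
  1≉0 = proj₂ 1ˣ

  -- Uniqueness of inverses gives access to the totalised inverse without unfolding z̄/|z|²; `z` is
  -- nonzero because 1 is.
  *≈1⇒⁻¹≈ : ∀ {z w} → z * w ≈ 1# → z ⁻¹ ≈ w
  *≈1⇒⁻¹≈ {z} {w} p = begin
    z ⁻¹              ≈⟨ C.*-identityʳ (z ⁻¹) ⟨
    z ⁻¹ * 1#         ≈⟨ C.*-congˡ {z ⁻¹} p ⟨
    z ⁻¹ * (z * w)    ≈⟨ C.*-assoc (z ⁻¹) z w ⟨
    z ⁻¹ * z * w      ≈⟨ C.*-congʳ {w} (C.*-comm (z ⁻¹) z) ⟩
    z * z ⁻¹ * w      ≈⟨ C.*-congʳ {w} (ℂ-inverse z z≉0) ⟩
    1# * w            ≈⟨ C.*-identityˡ w ⟩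
    w                 ∎
    where
    open import Relation.Binary.Reasoning.Setoid C.setoid
    z≉0 : ¬ (z ≈ 0#)
    z≉0 z≈0 = 1≉0 (C.trans {1#} (C.sym {z * w} p) (C.trans {z * w} (C.*-congʳ {w} z≈0) (C.zeroˡ w)))

  re-×ₙ : ∀ n → re (n ×ₙ 1#) R.≈ n R.×ₙ R.1#
  re-×ₙ zero    = R.refl
  re-×ₙ (suc n) = R.+-congˡ (re-×ₙ n)

  im-×ₙ : ∀ n → im (n ×ₙ 1#) R.≈ R.0#
  im-×ₙ zero    = R.refl
  im-×ₙ (suc n) = R.trans (R.+-identityˡ _) (im-×ₙ n)

  ×ₙ-inverse : ∀ n → suc n ×ₙ 1# * (suc n ×ₙ 1#) ⁻¹ ≈ 1#
  ×ₙ-inverse n = ℂ-inverse (suc n ×ₙ 1#) λ (p , _) →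
    >⇒≉ (<-≤-trans R.0<1 (1≤suc n)) (R.trans (R.sym (re-×ₙ (suc n))) p)

  ‖_‖₁ : ℂ → R.Carrier
  ‖ z ‖₁ = ∣ re z ∣ R.+ ∣ im z ∣

  private
    ∣0∣≤0 : ∣ R.0# ∣ ≤ R.0#
    ∣0∣≤0 = ∣∣-least ≤-refl (inj₂ -0≈0)

    ∣x∣≤0⇒x≈0 : ∀ {x} → ∣ x ∣ ≤ R.0# → x R.≈ R.0#
    ∣x∣≤0⇒x≈0 {x} p = x²≤0⇒x≈0 (≤-trans (x²≤∣x∣² x)
      (≤-trans (*-monoˡ-≤ (0≤∣∣ x) p) (inj₂ (R.zeroˡ _))))

    ∣x∣≤x : ∀ {x} → R.0# ≤ x → ∣ x ∣ ≤ x
    ∣x∣≤x p = ∣∣-least ≤-refl (≤-trans (≤-resp R.refl -0≈0 (-‿mono-≤ p)) p)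

  -- The ℓ¹ norm is used instead of the modulus because it needs no square root.
  ℂ-norm : CompleteNorm ℝ ℂ-commutativeRing
  ℂ-norm = record
    { ‖_‖      = ‖_‖₁
    ; ‖‖-cong≤ = λ (p , q) → +-mono-≤ (∣∣-cong-≤ p) (∣∣-cong-≤ q)
    ; 0≤‖‖     = λ z → ≤-trans (0≤∣∣ (re z)) (x≤x+y (0≤∣∣ (im z)))
    ; ‖0‖≤0    = ≤-trans (+-mono-≤ ∣0∣≤0 ∣0∣≤0) (inj₂ (R.+-identityˡ R.0#))
    ; ‖‖≤0⇒≈0  = λ {z} p → ∣x∣≤0⇒x≈0 (≤-trans (x≤x+y (0≤∣∣ (im z))) p)
                         , ∣x∣≤0⇒x≈0 (≤-trans (y≤x+y (0≤∣∣ (re z))) p)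
    ; ‖1‖≤1    = ≤-trans (+-mono-≤ (∣x∣≤x 0≤1) ∣0∣≤0) (inj₂ (R.+-identityʳ R.1#))
    ; ‖‖-+     = λ (a +i b) (d +i e) → ≤-trans (+-mono-≤ (∣∣-+ a d) (∣∣-+ b e))
                   (inj₂ (solve 4 (λ a b d e → (a :+ d) :+ (b :+ e) := (a :+ b) :+ (d :+ e)) R.refl _ _ _ _))
    ; ‖‖-*     = λ (a +i b) (d +i e) → ≤-trans
                   (+-mono-≤
                     (≤-trans (∣∣-+ (a R.* d) (R.- (b R.* e)))
                       (+-mono-≤ (∣∣-* a d) (≤-trans (∣∣-neg (b R.* e)) (∣∣-* b e))))
                     (≤-trans (∣∣-+ (a R.* e) (b R.* d)) (+-mono-≤ (∣∣-* a e) (∣∣-* b d))))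
                   (inj₂ (solve 4 (λ a b d e → (a :* d :+ b :* e) :+ (a :* e :+ b :* d) := (a :+ b) :* (d :+ e)) R.refl _ _ _ _))
    ; ‖‖-neg   = λ (a +i b) → +-mono-≤ (∣∣-neg a) (∣∣-neg b)
    ; geometric-limit = limit
    }
    where
    limit : ∀ s A → (∀ n → ‖ s (suc n) - s n ‖₁ ≤ A R.* h R.^ n) →
            ∃[ l ] ∀ ε → R.0# R.< ε → ∃[ N ] (∀ n → N ℕ.≤ n → ‖ s n - l ‖₁ R.< ε)
    limit s A p =
      let a , re⟶ = OrderedField.geometric-limit ℝ (λ n → re (s n)) A (λ n → ≤-trans (x≤x+y (0≤∣∣ _)) (p n))
          b , im⟶ = OrderedField.geometric-limit ℝ (λ n → im (s n)) A (λ n → ≤-trans (y≤x+y (0≤∣∣ _)) (p n))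
      in a +i b , λ ε 0<ε →
      let 0<hε  = R.*-pos 0<h 0<ε
          M , q = re⟶ (h R.* ε) 0<hε
          N , r = im⟶ (h R.* ε) 0<hε
      in M ℕ.⊔ N , λ n M⊔N≤n → <-resp R.refl (halves ε)
           (+-mono-< (within (q n (ℕ.≤-trans (ℕ.m≤m⊔n M N) M⊔N≤n)))
                     (within (r n (ℕ.≤-trans (ℕ.m≤n⊔m M N) M⊔N≤n))))
      where
      within : ∀ {x ε} → (R.- ε R.< x) × (x R.< ε) → ∣ x ∣ R.< ε
      within (p , q) = ∣∣-least-< q (<-resp R.refl (solve 1 (λ x → :- :- x := x) R.refl _) (-‿mono-< p))

  open CompleteNorm ℂ-norm public renaming (_⟶_ to _⟶₁_)

  ∣z∣²≤‖z‖² : ∀ z → ∣ z ∣² ≤ ‖ z ‖ R.* ‖ z ‖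
  ∣z∣²≤‖z‖² (a +i b) = ≤-trans (+-mono-≤ (x²≤∣x∣² a) (x²≤∣x∣² b)) (≤-trans
    (x≤x+y (0≤* (0≤* (inj₁ 0<2) (0≤∣∣ a)) (0≤∣∣ b)))
    (inj₂ (solve 2 (λ a b → a :* a :+ b :* b :+ (con (+ 1) :+ con (+ 1)) :* a :* b := (a :+ b) :* (a :+ b)) R.refl _ _)))

  ‖‖<⇒∣∣< : ∀ {z ε} → R.0# R.< ε → ‖ z ‖ R.< ε → ∣ z ∣< ε
  ‖‖<⇒∣∣< {z} 0<ε p = ≤-<-trans (∣z∣²≤‖z‖² z)
    (≤-<-trans (*-monoʳ-≤ (0≤‖‖ z) (inj₁ p)) (*-monoˡ-< 0<ε p))

  -- Turns the disc of the theorem, given by the modulus, into a condition on the ℓ¹ norm: each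
  -- coordinate is below ε.
  ∣∣<⇒‖‖< : ∀ {z ε} → R.0# R.< ε → ∣ z ∣< ε → ‖ z ‖ R.< ε R.+ ε
  ∣∣<⇒‖‖< {a +i b} 0<ε p = +-mono-<
    (x²<y²⇒x<y (inj₁ 0<ε) (≤-<-trans (∣x∣²≤x² a) (≤-<-trans (x≤x+y (0≤x² b)) p)))
    (x²<y²⇒x<y (inj₁ 0<ε) (≤-<-trans (∣x∣²≤x² b) (≤-<-trans (y≤x+y (0≤x² a)) p)))

  ⟶₁⇒⟶ : ∀ {s l} → s ⟶₁ l → s ⟶ l
  ⟶₁⇒⟶ p ε 0<ε = let N , q = p ε 0<ε in N , λ n N≤n → ‖‖<⇒∣∣< 0<ε (q n N≤n)

  inv : ℕ → ℂ
  inv n = (suc n ×ₙ 1#) ⁻¹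

  -- The reason why integration preserves geometric bounds: it divides coefficients by integers that
  -- are at least 1.
  ‖inv‖≤1 : ∀ n → ‖ inv n ‖ ≤ R.1#
  ‖inv‖≤1 n = ≤-trans (‖‖-cong≤ (*≈1⇒⁻¹≈ {suc n ×ₙ 1#} {r⁻¹ +i R.0#} inverse))
    (≤-trans (+-mono-≤ (∣x∣≤x (inj₁ 0<r⁻¹)) ∣0∣≤0) (≤-trans (inj₂ (R.+-identityʳ r⁻¹)) r⁻¹≤1))
    where
    r   = suc n R.×ₙ R.1#
    r⁻¹ = r R.⁻¹

    0<r : R.0# R.< r
    0<r = <-≤-trans R.0<1 (1≤suc n)

    0<r⁻¹ : R.0# R.< r⁻¹
    0<r⁻¹ = ⁻¹-pos 0<r

    rr⁻¹ : r R.* r⁻¹ R.≈ R.1#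
    rr⁻¹ = *-inverse (>⇒≉ 0<r)

    r⁻¹≤1 : r⁻¹ ≤ R.1#
    r⁻¹≤1 = ≤-resp (R.*-identityˡ r⁻¹) rr⁻¹ (*-monoˡ-≤ (inj₁ 0<r⁻¹) (1≤suc n))

    inverse : suc n ×ₙ 1# * (r⁻¹ +i R.0#) ≈ 1#
    inverse =
      R.trans (R.+-cong (R.*-congʳ (re-×ₙ (suc n))) (R.-‿cong (R.zeroʳ _)))
        (R.trans (solve 1 (λ a → a :- con (+ 0) := a) R.refl _) rr⁻¹) ,
      R.trans (R.+-cong (R.zeroʳ _) (R.trans (R.*-congʳ (im-×ₙ (suc n))) (R.zeroˡ _))) (R.+-identityˡ R.0#)

-- Noncommutative polynomials acting on sequences.

module Evaluation {a ℓ₁ ℓ₂ c ℓ} (ℝ : CompleteOrderedField a ℓ₁ ℓ₂) (C : CommutativeRing c ℓ)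
                  (fromℚ : ℚ → CommutativeRing.Carrier C) where

  open Polylogarithms ℝ using (Letter; Word; 𝒜; _·_; _⊗_; hom; homWord)
  open CommutativeRing C
  open IntegerCoefficients C
  open FormalSubstitution C
  open import Relation.Binary.Reasoning.Setoid setoid

  record IsLinear (f : Seq → Seq) : Set (c ⊔ ℓ) where
    field
      resp   : ∀ {c d} → c ≋ d → f c ≋ f d
      f-+    : ∀ c d → f (c +ˢ d) ≋ f c +ˢ f d
      f-*    : ∀ b c → f (b *ˢ c) ≋ b *ˢ f c

    f-0 : f 0ˢ ≋ 0ˢ
    f-0 n = begin
      f 0ˢ n            ≈⟨ resp (λ _ → zeroˡ 0#) n ⟨
      f (0# *ˢ 0ˢ) n    ≈⟨ f-* 0# 0ˢ n ⟩
      0# * f 0ˢ n       ≈⟨ zeroˡ _ ⟩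
      0#                ∎

  open IsLinear

  -- An assignment of operators to letters. Concatenation of words becomes composition of operators,
  -- the leftmost letter acting last, just as in an iterated integral.
  Action : Set (a ⊔ ℓ₁ ⊔ c)
  Action = Letter → Seq → Seq

  evalWord : Action → Word → Seq → Seq
  evalWord ρ v c = foldr ρ c v

  eval : Action → 𝒜 → Seq → Seq
  eval ρ []            c = 0ˢ
  eval ρ ((q , v) ∷ w) c = fromℚ q *ˢ evalWord ρ v c +ˢ eval ρ w c

  module _ {ρ : Action} (lin : ∀ b → IsLinear (ρ b)) where

    evalWord-linear : ∀ v → IsLinear (evalWord ρ v)
    evalWord-linear [] = record
      { resp = λ p → p ; f-+ = λ _ _ _ → refl ; f-* = λ _ _ _ → refl }
    evalWord-linear (b ∷ v) = record
      { resp = λ p → lin b .resp (ih .resp p)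
      ; f-+  = λ c d n → trans (lin b .resp (ih .f-+ c d) n) (lin b .f-+ _ _ n)
      ; f-*  = λ e c n → trans (lin b .resp (ih .f-* e c) n) (lin b .f-* e _ n)
      }
      where ih = evalWord-linear v

    eval-linear : ∀ w → IsLinear (eval ρ w)
    eval-linear [] = record
      { resp = λ _ _ → refl
      ; f-+  = λ _ _ _ → sym (+-identityˡ 0#)
      ; f-*  = λ b _ _ → sym (zeroʳ b)
      }
    eval-linear ((q , v) ∷ w) = record
      { resp = λ p n → +-cong (*-congˡ (word .resp p n)) (ih .resp p n)
      ; f-+  = λ c d n → trans (+-cong (*-congˡ (word .f-+ c d n)) (ih .f-+ c d n))
                 (solve 5 (λ q a b c d → q :* (a :+ b) :+ (c :+ d) := (q :* a :+ c) :+ (q :* b :+ d)) refl _ _ _ _ _)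
      ; f-*  = λ e c n → trans (+-cong (*-congˡ (word .f-* e c n)) (ih .f-* e c n))
                 (solve 4 (λ q e a b → q :* (e :* a) :+ e :* b := e :* (q :* a :+ b)) refl _ _ _ _)
      }
      where
      word = evalWord-linear v
      ih   = eval-linear w

  eval-++ : ∀ ρ w w′ c → eval ρ (w ++ w′) c ≋ eval ρ w c +ˢ eval ρ w′ c
  eval-++ ρ []            w′ c n = sym (+-identityˡ _)
  eval-++ ρ ((q , v) ∷ w) w′ c n = trans (+-congˡ (eval-++ ρ w w′ c n)) (sym (+-assoc _ _ _))

  module _ (fromℚ-* : ∀ p q → fromℚ (p ℚ.* q) ≈ fromℚ p * fromℚ q)
           (fromℚ-1 : fromℚ 1ℚ ≈ 1#) where

    eval-· : ∀ ρ q w c → eval ρ (q · w) c ≋ fromℚ q *ˢ eval ρ w c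
    eval-· ρ q []            c n = sym (zeroʳ _)
    eval-· ρ q ((r , v) ∷ w) c n = trans
      (+-cong (trans (*-congʳ (fromℚ-* q r)) (*-assoc _ _ _)) (eval-· ρ q w c n))
      (sym (distribˡ _ _ _))

    eval-letter : ∀ ρ b c → eval ρ ((1ℚ , b ∷ []) ∷ []) c ≋ ρ b c
    eval-letter ρ b c n = trans (+-identityʳ _) (trans (*-congʳ fromℚ-1) (*-identityˡ _))

    module _ {ρ : Action} (lin : ∀ b → IsLinear (ρ b)) where

      private
        eval-term : ∀ q u w c → eval ρ (map (λ (r , v) → q ℚ.* r , u ++ v) w) c ≋
                                fromℚ q *ˢ evalWord ρ u (eval ρ w c)
        eval-term q u []            c n =
          sym (trans (*-congˡ (f-0 (evalWord-linear lin u) n)) (zeroʳ _))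
        eval-term q u ((r , v) ∷ w) c n = begin
          fromℚ (q ℚ.* r) * evalWord ρ (u ++ v) c n + eval ρ (map _ w) c n
            ≈⟨ +-cong (*-cong (fromℚ-* q r) (reflexive (≡.cong (λ d → d n) (foldr-++ ρ c u v)))) (eval-term q u w c n) ⟩
          (fromℚ q * fromℚ r) * evalWord ρ u (evalWord ρ v c) n + fromℚ q * evalWord ρ u (eval ρ w c) n
            ≈⟨ solve 4 (λ q r a b → (q :* r) :* a :+ q :* b := q :* (r :* a :+ b)) refl _ _ _ _ ⟩
          fromℚ q * (fromℚ r * evalWord ρ u (evalWord ρ v c) n + evalWord ρ u (eval ρ w c) n)
            ≈⟨ *-congˡ (+-congʳ (evalWord-linear lin u .f-* _ _ n)) ⟨
          fromℚ q * (evalWord ρ u (fromℚ r *ˢ evalWord ρ v c) n + evalWord ρ u (eval ρ w c) n)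
            ≈⟨ *-congˡ (evalWord-linear lin u .f-+ _ _ n) ⟨
          fromℚ q * evalWord ρ u (eval ρ ((r , v) ∷ w) c) n ∎

      -- Linearity is what lets the coefficients and sums of the right factor pass through the
      -- operators of the left one.
      eval-⊗ : ∀ w w′ c → eval ρ (w ⊗ w′) c ≋ eval ρ w (eval ρ w′ c)
      eval-⊗ []            w′ c n = refl
      eval-⊗ ((q , u) ∷ w) w′ c n = trans (eval-++ ρ (map _ w′) (w ⊗ w′) c n)
        (+-cong (eval-term q u w′ c n) (eval-⊗ w w′ c n))

      eval-homWord : ∀ f v c → eval ρ (homWord f v) c ≋ evalWord (λ b → eval ρ (f b)) v c
      eval-homWord f []      c n = trans (+-identityʳ _) (trans (*-congʳ fromℚ-1) (*-identityˡ _))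
      eval-homWord f (b ∷ v) c n = trans (eval-⊗ (f b) (homWord f v) c n)
        (eval-linear lin (f b) .resp (eval-homWord f v c) n)

      -- Both sides are multiplicative and linear in w and agree on letters. This transfers a
      -- homomorphism to the action, where it has to be computed on letters only.
      eval-hom : ∀ f w c → eval ρ (hom f w) c ≋ eval (λ b → eval ρ (f b)) w c
      eval-hom f []            c n = refl
      eval-hom f ((q , v) ∷ w) c n = trans (eval-++ ρ (q · homWord f v) (hom f w) c n)
        (+-cong (trans (eval-· ρ q (homWord f v) c n) (*-congˡ (eval-homWord f v c n)))
                (eval-hom f w c n))

-- Series attached to words, and the formal identity.

module GeometricSums {c ℓ} (R : CommutativeRing c ℓ) where

  open CommutativeRing R
  open RawSemiringDefinitions (Semiring.rawSemiring semiring) using (_^_)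
  open CommutativeMonoidSum +-commutativeMonoid using (sum; sum-cong-≋)
  open IntegerCoefficients R
  open FormalSubstitution R

  -- `Geo` recurses at its last term, the finite sum in `coeff` at its first. Splitting off `c 0`
  -- reconciles the two.
  Geo-cons : ∀ s c n → Geo s c (suc n) ≈ s ^ suc n * c 0 + Geo s (tail c) n
  Geo-cons s c zero    = solve 2 (λ s a → s :* (con (+ 0) :+ a) := s :* con (+ 1) :* a :+ con (+ 0)) refl s (c 0)
  Geo-cons s c (suc n) = trans (*-congˡ (+-congʳ (Geo-cons s c n)))
    (solve 5 (λ s p a g b → s :* ((p :* a :+ g) :+ b) := (s :* p) :* a :+ s :* (g :+ b)) refl _ _ _ _ _)

  sum-Geo : ∀ s c n → sum {n} (λ i → s ^ (n ∸ toℕ i) * c (toℕ i)) ≈ Geo s c n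
  sum-Geo s c zero    = refl
  sum-Geo s c (suc n) = trans (+-congˡ (sum-Geo s (tail c) n)) (sym (Geo-cons s c n))

  power-inverse : ∀ {z w} k → z * w ≈ 1# → z ^ k * w ^ k ≈ 1#
  power-inverse zero    p = *-identityˡ 1#
  power-inverse {z} {w} (suc k) p = trans
    (solve 4 (λ a b c d → a :* b :* (c :* d) := (a :* c) :* (b :* d)) refl z (z ^ k) w (w ^ k))
    (trans (*-cong p (power-inverse k p)) (*-identityˡ 1#))

  0*a-a : ∀ a → 0# * a + - 1# * a ≈ - 1# * a
  0*a-a a = trans (+-congʳ (zeroˡ a)) (+-identityˡ _)

  1*a+0*b : ∀ a b → 1# * a + 0# * b ≈ a
  1*a+0*b = solve 2 (λ a b → con (+ 1) :* a :+ con (+ 0) :* b := a) refl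

  1-s≈1⇒s≈0 : ∀ {s} → 1# - s ≈ 1# → s ≈ 0#
  1-s≈1⇒s≈0 {s} p = trans (solve 1 (λ s → s := con (+ 1) :- (con (+ 1) :- s)) refl s)
    (trans (+-congˡ (-‿cong p)) (-‿inverseʳ 1#))

module WordSeries {c ℓ₁ ℓ₂} (ℝ : CompleteOrderedField c ℓ₁ ℓ₂) where

  open Polylogarithms ℝ
  open ComplexField ℝ
  private module C = CommutativeRing ℂ-commutativeRing
  open FormalSubstitution ℂ-commutativeRing
  open Integration inv ×ₙ-inverse
  open Evaluation ℝ ℂ-commutativeRing fromℚ
  open IsLinear
  open GeometricSums ℂ-commutativeRing
  open import Relation.Binary.Reasoning.Setoid C.setoid

  X-linear : IsLinear X
  X-linear = record { resp = ∫-cong ; f-+ = ∫-+ ; f-* = ∫-* }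

  Y-linear : ∀ s → IsLinear (Y s)
  Y-linear s = record
    { resp = λ p → ∫-cong (Geo-cong C.refl p)
    ; f-+  = λ c d n → C.trans (∫-cong (Geo-+ s c d) n) (∫-+ _ _ n)
    ; f-*  = λ b c n → C.trans (∫-cong (Geo-* s b c) n) (∫-* b _ n)
    }

  ρ : Action
  ρ x           = X
  ρ (y (s , _)) = Y s

  ρ-linear : ∀ b → IsLinear (ρ b)
  ρ-linear x           = X-linear
  ρ-linear (y (s , _)) = Y-linear s

  one : Seq
  one = coeff []

  T-one : T one ≋ one
  T-one zero    = C.refl
  T-one (suc n) = C.trans (C.sym (T-shift (tail one) (suc n)))
    (C.trans (T-cong {shift (tail one)} {0ˢ} (λ { zero → C.refl ; (suc _) → C.refl }) (suc n)) (T-0 (suc n)))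

  ρ-const : ∀ b c → ρ b c 0 ≈ 0#
  ρ-const x     c = C.refl
  ρ-const (y _) c = C.refl

  evalWord-const : ∀ u b → evalWord ρ (u ∷ʳ b) one 0 ≈ 0#
  evalWord-const []      b = ρ-const b one
  evalWord-const (a ∷ u) b = ρ-const a _

  -- Of the k + 1 divisions by n + 1, one is the integration inside `Y s`; the other k belong to the
  -- letters x in front of this y.
  coeff-y : ∀ k s ks v → coeff ks ≋ evalWord ρ v one → ∀ n →
            coeff ((suc k , s) ∷ ks) (suc n) ≈ evalWord ρ (y s ∷ v) one (suc n) * inv n ^ k
  coeff-y k (s , _) ks v p n = begin
    ∑< (suc n) (λ m → s ^ (suc n ∸ m) * coeff ks m) * ((suc n ×ₙ 1#) ^ suc k) ⁻¹
      ≈⟨ C.*-cong {∑< (suc n) (λ m → s ^ (suc n ∸ m) * coeff ks m)} {Geo s d (suc n)} {((suc n ×ₙ 1#) ^ suc k) ⁻¹} {inv n ^ suc k}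
           (C.trans {j = Geo s (coeff ks) (suc n)} (sum-Geo s (coeff ks) (suc n)) (Geo-cong {s} {s} C.refl p (suc n)))
           (*≈1⇒⁻¹≈ {(suc n ×ₙ 1#) ^ suc k} {inv n ^ suc k} (power-inverse {suc n ×ₙ 1#} {inv n} (suc k) (×ₙ-inverse n))) ⟩
    Geo s d (suc n) * (inv n * inv n ^ k)
      ≈⟨ C.*-assoc (Geo s d (suc n)) (inv n) (inv n ^ k) ⟨
    Geo s d (suc n) * inv n * inv n ^ k ∎
    where d = evalWord ρ v one

  -- The counter k of `indexFrom` is generalised: the k letters x already read are integrations
  -- still to be applied, each dividing by n + 1. The constant coefficient is treated apart because
  -- `inv n` is 1/(n+1). A letter y resets the counter, which leads back to `coeff-index`.
  coeff-word : ∀ u s k → (coeff (indexFrom k (u ∷ʳ y s)) 0 ≈ 0#) × (∀ n →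
               coeff (indexFrom k (u ∷ʳ y s)) (suc n) ≈ evalWord ρ (u ∷ʳ y s) one (suc n) * inv n ^ k)
  coeff-index : ∀ u s → coeff (index (u ∷ʳ y s)) ≋ evalWord ρ (u ∷ʳ y s) one

  coeff-word []        s k = C.zeroˡ (((0 ×ₙ 1#) ^ suc k) ⁻¹) , coeff-y k s [] [] (λ _ → C.refl)
  coeff-word (x ∷ u)   s k = proj₁ (coeff-word u s (suc k)) , λ n →
    C.trans {j = evalWord ρ (u ∷ʳ y s) one (suc n) * (inv n * inv n ^ k)} (proj₂ (coeff-word u s (suc k)) n)
      (C.sym {evalWord ρ (u ∷ʳ y s) one (suc n) * inv n * inv n ^ k}
        (C.*-assoc (evalWord ρ (u ∷ʳ y s) one (suc n)) (inv n) (inv n ^ k)))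
  coeff-word (y t ∷ u) s k = C.zeroˡ (((0 ×ₙ 1#) ^ suc k) ⁻¹) ,
    coeff-y k t (index (u ∷ʳ y s)) (u ∷ʳ y s) (coeff-index u s)

  coeff-index u s zero    = C.trans {j = 0#} (proj₁ (coeff-word u s 0)) (C.sym {evalWord ρ (u ∷ʳ y s) one 0} (evalWord-const u (y s)))
  coeff-index u s (suc n) = C.trans {j = evalWord ρ (u ∷ʳ y s) one (suc n) * 1#} (proj₂ (coeff-word u s 0) n) (C.*-identityʳ _)

  coeff-𝒜¹ : ∀ {v} → v ≡ [] ⊎ EndsInY v → coeff (index v) ≋ evalWord ρ v one
  coeff-𝒜¹ (inj₁ ≡.refl)           _ = C.refl
  coeff-𝒜¹ (inj₂ (u , s , ≡.refl)) = coeff-index u s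

  δ≡0 : ∀ {s} → s ≈ 1# → δ s ≡ 0ℚ
  δ≡0 {s} p = ≡.cong (if_then 0ℚ else 1ℚ)
    (≡.trans (isYes≗does ((s ≟ 0#) ⊎-dec (s ≟ 1#))) (dec-true ((s ≟ 0#) ⊎-dec (s ≟ 1#)) (inj₂ p)))

  δ≡1 : ∀ {s} → ¬ (s ≈ 0#) → ¬ (s ≈ 1#) → δ s ≡ 1ℚ
  δ≡1 {s} p q = ≡.cong (if_then 0ℚ else 1ℚ)
    (≡.trans (isYes≗does ((s ≟ 0#) ⊎-dec (s ≟ 1#))) (dec-false ((s ≟ 0#) ⊎-dec (s ≟ 1#)) λ { (inj₁ r) → p r ; (inj₂ r) → q r }))

  -- Pulling back an action reverses the order: the letters of `ι-letter a` act through φ, so `ρφι`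
  -- belongs to φ after ι.
  ρφ ρφι : Action
  ρφ  a = eval ρ  (φ-letter a)
  ρφι a = eval ρφ (ι-letter a)

  ρφ-linear : ∀ b → IsLinear (ρφ b)
  ρφ-linear b = eval-linear ρ-linear (φ-letter b)

  eval-φι : ∀ w c → eval ρ (φ (ι w)) c ≋ eval ρφι w c
  eval-φι w c n = C.trans (eval-hom fromℚ-* fromℚ-1 ρ-linear φ-letter (ι w) c n)
                          (eval-hom fromℚ-* fromℚ-1 ρφ-linear ι-letter w c n)

  private
    eval-pair : ∀ σ p q a b c → eval σ ((p , a ∷ []) ∷ (q , b ∷ []) ∷ []) c ≋
                                fromℚ p *ˢ σ a c +ˢ fromℚ q *ˢ σ b c
    eval-pair σ p q a b c n = C.+-congˡ {fromℚ p * σ a c n} (C.+-identityʳ (fromℚ q * σ b c n))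

  ρφ-y : ∀ s {b} c → fromℚ (δ (proj₁ s)) ≈ b →
         ρφ (y s) c ≋ b *ˢ Y (proj₁ s) c +ˢ (- 1#) *ˢ Y 1# c
  ρφ-y s {b} c p n = begin
    ρφ (y s) c n
      ≈⟨ eval-pair ρ (δ (proj₁ s) ℚ.* 1ℚ) ((ℚ.- 1ℚ) ℚ.* 1ℚ) (y s) (y 1ˣ) c n ⟩
    fromℚ (δ (proj₁ s) ℚ.* 1ℚ) * Y (proj₁ s) c n + fromℚ ((ℚ.- 1ℚ) ℚ.* 1ℚ) * Y 1# c n
      ≈⟨ C.+-cong {fromℚ (δ (proj₁ s) ℚ.* 1ℚ) * Y (proj₁ s) c n} {b * Y (proj₁ s) c n}
           (C.*-congʳ {Y (proj₁ s) c n} (C.trans {j = fromℚ (δ (proj₁ s)) * fromℚ 1ℚ} (fromℚ-* (δ (proj₁ s)) 1ℚ)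
              (C.trans {j = fromℚ (δ (proj₁ s)) * 1#} (C.*-congˡ {fromℚ (δ (proj₁ s))} fromℚ-1) (C.trans {j = fromℚ (δ (proj₁ s))} (C.*-identityʳ (fromℚ (δ (proj₁ s)))) p))))
           (C.*-congʳ {Y 1# c n} fromℚ--1) ⟩
    b * Y (proj₁ s) c n + - 1# * Y 1# c n ∎

  ρφ-y₁ : ∀ c → ρφ (y 1ˣ) c ≋ (- 1#) *ˢ Y 1# c
  ρφ-y₁ c n = C.trans {j = 0# * Y 1# c n + - 1# * Y 1# c n}
    (ρφ-y 1ˣ {0#} c (C.trans {j = fromℚ 0ℚ} (C.reflexive (≡.cong fromℚ (δ≡0 C.refl))) fromℚ-0) n)
    (0*a-a (Y 1# c n))

  ρφι-x : ∀ c → ρφι x c ≋ X c +ˢ Y 1# c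
  ρφι-x c n = C.trans {j = ρφ x c n} (eval-letter fromℚ-* fromℚ-1 ρφ x c n)
    (C.trans {j = fromℚ 1ℚ * X c n + fromℚ 1ℚ * Y 1# c n} (eval-pair ρ 1ℚ 1ℚ x (y 1ˣ) c n)
      (C.+-cong {fromℚ 1ℚ * X c n} {X c n} (unit (X c n)) (unit (Y 1# c n))))
    where
    unit : ∀ z → fromℚ 1ℚ * z ≈ z
    unit z = C.trans {j = 1# * z} (C.*-congʳ {z} fromℚ-1) (C.*-identityˡ z)

  δ·y₁₋-≈1 : ∀ {s} → proj₁ s ≈ 1# → δ·y₁₋ s ≡ []
  δ·y₁₋-≈1 {s} p with proj₁ s ≟ 1#
  ... | yes _ = ≡.refl
  ... | no ¬p = ⊥-elim (¬p p)

  δ·y₁₋-≉1 : ∀ {s} → ¬ (proj₁ s ≈ 1#) → ∃[ p ] δ·y₁₋ s ≡ letter (y (1-ˣ s p))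
  δ·y₁₋-≉1 {s} ¬p with proj₁ s ≟ 1#
  ... | yes p = ⊥-elim (¬p p)
  ... | no ¬p = ¬p , ≡.cong (_· letter (y (1-ˣ s ¬p))) (δ≡1 (proj₂ s) ¬p)

  private
    module _ (s : ℂˣ) (c : Seq) (n : ℕ) where

      A B : ℂ
      A = Y (1# - proj₁ s) c n
      B = Y 1# c n

      ρφι-y-≈1 : proj₁ s ≈ 1# → ρφι (y s) c n ≈ A + - 1# * B
      ρφι-y-≈1 p = begin
        ρφι (y s) c n
          ≡⟨ ≡.cong₂ (λ w d → eval ρφ (w ⊕ (1ℚ ℚ.- d) · letter (y 1ˣ)) c n) (δ·y₁₋-≈1 {s} p) (δ≡0 p) ⟩
        eval ρφ (letter (y 1ˣ)) c n
          ≈⟨ eval-letter fromℚ-* fromℚ-1 ρφ (y 1ˣ) c n ⟩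
        ρφ (y 1ˣ) c n
          ≈⟨ ρφ-y₁ c n ⟩
        - 1# * B
          ≈⟨ C.+-identityˡ (- 1# * B) ⟨
        0# + - 1# * B
          ≈⟨ C.+-congʳ { - 1# * B} {A} {0#} A≈0 ⟨
        A + - 1# * B ∎
        where
        1-s≈0 : 1# - proj₁ s ≈ 0#
        1-s≈0 = C.trans {j = 1# - 1#} (C.+-congˡ {1#} (C.-‿cong p)) (C.-‿inverseʳ 1#)

        A≈0 : A ≈ 0#
        A≈0 = C.trans {j = ∫ 0ˢ n}
          (∫-cong (λ m → C.trans {j = Geo 0# c m} (Geo-cong {1# - proj₁ s} {0#} 1-s≈0 (λ _ → C.refl) m) (Geo-0 c m)) n)
          (C.trans {j = 0# * ∫ 0ˢ n} (C.trans {j = ∫ (0# *ˢ 0ˢ) n} (∫-cong {0ˢ} {0# *ˢ 0ˢ} (λ _ → C.sym {0# * 0#} (C.zeroˡ 0#)) n) (∫-* 0# 0ˢ n)) (C.zeroˡ (∫ 0ˢ n)))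

      ρφι-y-≉1 : ¬ (proj₁ s ≈ 1#) → ρφι (y s) c n ≈ A + - 1# * B
      ρφι-y-≉1 ¬p = let q , δ·y₁₋≡ = δ·y₁₋-≉1 {s} ¬p in begin
        ρφι (y s) c n
          ≡⟨ ≡.cong₂ (λ w d → eval ρφ (w ⊕ (1ℚ ℚ.- d) · letter (y 1ˣ)) c n) δ·y₁₋≡ (δ≡1 (proj₂ s) ¬p) ⟩
        eval ρφ ((1ℚ , y (1-ˣ s q) ∷ []) ∷ (0ℚ , y 1ˣ ∷ []) ∷ []) c n
          ≈⟨ eval-pair ρφ 1ℚ 0ℚ (y (1-ˣ s q)) (y 1ˣ) c n ⟩
        fromℚ 1ℚ * ρφ (y (1-ˣ s q)) c n + fromℚ 0ℚ * ρφ (y 1ˣ) c n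
          ≈⟨ C.+-cong {fromℚ 1ℚ * ρφ (y (1-ˣ s q)) c n} {1# * ρφ (y (1-ˣ s q)) c n}
               (C.*-congʳ {ρφ (y (1-ˣ s q)) c n} fromℚ-1) (C.*-congʳ {ρφ (y 1ˣ) c n} fromℚ-0) ⟩
        1# * ρφ (y (1-ˣ s q)) c n + 0# * ρφ (y 1ˣ) c n
          ≈⟨ 1*a+0*b (ρφ (y (1-ˣ s q)) c n) (ρφ (y 1ˣ) c n) ⟩
        ρφ (y (1-ˣ s q)) c n
          -- δ(1-s) = 1: the number 1-s is nonzero, and 1-s = 1 would give s = 0.
          ≈⟨ ρφ-y (1-ˣ s q) {1#} c (C.trans {j = fromℚ 1ℚ} (C.reflexive (≡.cong fromℚ
               (δ≡1 (proj₂ (1-ˣ s q)) (λ r → proj₂ s (1-s≈1⇒s≈0 {proj₁ s} r))))) fromℚ-1) n ⟩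
        1# * A + - 1# * B
          ≈⟨ C.+-congʳ { - 1# * B} (C.*-identityˡ A) ⟩
        A + - 1# * B ∎

  -- One formula serves both cases: at s = 1 the operator `Y` with parameter 0 vanishes and stands
  -- in for the absent letter y₀. Thus `T-Y` applies to every s.
  ρφι-y : ∀ s c → ρφι (y s) c ≋ Y (1# - proj₁ s) c +ˢ (- 1#) *ˢ Y 1# c
  ρφι-y s c n = [ ρφι-y-≈1 s c n , ρφι-y-≉1 s c n ]′ (toSum (proj₁ s ≟ 1#))

  T-ρ-x : ∀ c → c 0 ≈ 0# → T (ρφι x c) ≋ X (T c)
  T-ρ-x c c₀ n = C.trans (T-cong (ρφι-x c) n) (T-X c c₀ n)

  T-ρ-y : ∀ s c → T (ρφι (y s) c) ≋ Y (proj₁ s) (T c)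
  T-ρ-y s c n = C.trans (T-cong (ρφι-y s c) n) (T-Y (proj₁ s) c n)

  T-word : ∀ u s → T (evalWord ρφι (u ∷ʳ y s) one) ≋ evalWord ρ (u ∷ʳ y s) one
  T-word []        s n = C.trans (T-ρ-y s one n) (Y-linear (proj₁ s) .resp T-one n)
  T-word (x ∷ u)   s n = C.trans (T-ρ-x (evalWord ρφι (u ∷ʳ y s) one) const n) (X-linear .resp (T-word u s) n)
    where
    -- `T` fixes the constant coefficient by definition, so the induction hypothesis at 0 moves the
    -- condition to the action `ρ`, where every operator kills constant terms.
    const : evalWord ρφι (u ∷ʳ y s) one 0 ≈ 0#
    const = C.trans {evalWord ρφι (u ∷ʳ y s) one 0} {evalWord ρ (u ∷ʳ y s) one 0} (T-word u s 0) (evalWord-const u (y s))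
  T-word (y t ∷ u) s n = C.trans (T-ρ-y t (evalWord ρφι (u ∷ʳ y s) one) n) (Y-linear (proj₁ t) .resp (T-word u s) n)

  T-eval : ∀ {w} → w ∈𝒜¹ → T (eval ρφι w one) ≋ eval ρ w one
  T-eval               []       n = T-0 n
  T-eval {(q , v) ∷ w} (p ∷ ps) n = begin
    T (fromℚ q *ˢ evalWord ρφι v one +ˢ eval ρφι w one) n
      ≈⟨ T-+ (fromℚ q *ˢ evalWord ρφι v one) (eval ρφι w one) n ⟩
    T (fromℚ q *ˢ evalWord ρφι v one) n + T (eval ρφι w one) n
      ≈⟨ C.+-cong {T (fromℚ q *ˢ evalWord ρφι v one) n} {fromℚ q * evalWord ρ v one n}
           (C.trans {j = fromℚ q * T (evalWord ρφι v one) n} (T-* (fromℚ q) (evalWord ρφι v one) n) (C.*-congˡ {fromℚ q} (word p n)))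
           (T-eval ps n) ⟩
    fromℚ q * evalWord ρ v one n + eval ρ w one n ∎
    where
    word : ∀ {v} → v ≡ [] ⊎ EndsInY v → T (evalWord ρφι v one) ≋ evalWord ρ v one
    word (inj₁ ≡.refl)           = T-one
    word (inj₂ (u , s , ≡.refl)) = T-word u s

  T-φι : ∀ {w} → w ∈𝒜¹ → T (eval ρ (φ (ι w)) one) ≋ eval ρ w one
  T-φι {w} p n = C.trans (T-cong (eval-φι w one) n) (T-eval p n)

-- Geometric bounds for coefficients, limits of combinations, and the size of u.

module Bounds {a ℓ₁ ℓ₂ c ℓ} (ℝ : CompleteOrderedField a ℓ₁ ℓ₂)
              (C : CommutativeRing c ℓ) (norm : CompleteNorm ℝ C) where

  open CompleteOrderedField ℝ
  open OrderedField ℝ hiding (geometric-limit)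
  open IntegerCoefficients commutativeRing
  private module C = CommutativeRing C
  open C using () renaming (_+_ to _+ᶜ_; _*_ to _*ᶜ_; _-_ to _-ᶜ_; _≈_ to _≈ᶜ_)
  open RawSemiringDefinitions (Semiring.rawSemiring C.semiring) using () renaming (_×_ to _×ᶜ_)
  open CompleteNorm norm
  open FormalSubstitution C
  open PartialSums C
  open PowerSeries ℝ C norm
  open ≤-Reasoning

  module _ {A K : Carrier} (0≤A : 0# ≤ A) (1≤K : 1# ≤ K) where

    private
      0≤K : 0# ≤ K
      0≤K = ≤-trans 0≤1 1≤K

      0≤AK^ : ∀ n → 0# ≤ A * K ^ n
      0≤AK^ n = 0≤* 0≤A (0≤^ n 0≤K)

    -- Each step adds two terms of size at most A Kⁿ and multiplies by s, whence the condition 2‖s‖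
    -- ≤ K. The constant A is unchanged, so the same bound survives any number of letters.
    Geo-bound : ∀ {s c} → (1# + 1#) * ‖ s ‖ ≤ K → GeometricBound A K c → GeometricBound A K (Geo s c)
    Geo-bound         2s≤K b zero    = ≤-trans ‖0‖≤0 (0≤AK^ 0)
    Geo-bound {s} {c} 2s≤K b (suc n) = begin
      ‖ s *ᶜ (Geo s c n +ᶜ c n) ‖            ≤⟨ ‖‖-* _ _ ⟩
      ‖ s ‖ * ‖ Geo s c n +ᶜ c n ‖           ≤⟨ *-monoʳ-≤ (0≤‖‖ s) (≤-trans (‖‖-+ _ _) (+-mono-≤ (Geo-bound 2s≤K b n) (b n))) ⟩
      ‖ s ‖ * (A * K ^ n + A * K ^ n)        ≈⟨ solve 2 (λ s p → s :* (p :+ p) := (con (+ 1) :+ con (+ 1)) :* s :* p) refl _ _ ⟩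
      (1# + 1#) * ‖ s ‖ * (A * K ^ n)        ≤⟨ *-monoˡ-≤ (0≤AK^ n) 2s≤K ⟩
      K * (A * K ^ n)                        ≈⟨ solve 3 (λ k a p → k :* (a :* p) := a :* (k :* p)) refl _ _ _ ⟩
      A * (K * K ^ n)                        ∎

    module _ {inv : ℕ → C.Carrier} (inv-inverse : ∀ n → suc n ×ᶜ C.1# *ᶜ inv n ≈ᶜ C.1#)
             (‖inv‖≤1 : ∀ n → ‖ inv n ‖ ≤ 1#) where

      open Integration inv inv-inverse using (∫)

      ∫-bound : ∀ {c} → GeometricBound A K c → GeometricBound A K (∫ c)
      ∫-bound b zero    = ≤-trans ‖0‖≤0 (0≤AK^ 0)
      ∫-bound b (suc n) = ≤-trans (‖‖-* _ _)
        (≤-trans (*-mono-≤ (0≤‖‖ _) (0≤AK^ (suc n)) (b (suc n)) (‖inv‖≤1 n))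
                 (inj₂ (*-identityʳ _)))

  combine-bounds : ∀ {A B K p c d} → GeometricBound A K c → GeometricBound B K d →
                   GeometricBound (‖ p ‖ * A + B) K (p *ˢ c +ˢ d)
  combine-bounds {p = p} b b′ n = ≤-trans (‖‖-+ _ _) (≤-trans
    (+-mono-≤ (≤-trans (‖‖-* _ _) (*-monoʳ-≤ (0≤‖‖ p) (b n))) (b′ n))
    (inj₂ (solve 4 (λ p a b k → p :* (a :* k) :+ b :* k := (p :* a :+ b) :* k) refl _ _ _ _)))

  P-0-limit : ∀ z → P 0ˢ z ⟶ C.0#
  P-0-limit z = ⟶-cong (λ n → C.sym (P-0 z n)) (⟶-const C.0#)

  P-combine-limit : ∀ b c d z l m → P c z ⟶ l → P d z ⟶ m → P (b *ˢ c +ˢ d) z ⟶ b *ᶜ l +ᶜ m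
  P-combine-limit b c d z l m p q =
    ⟶-cong (λ n → C.sym (C.trans (P-+ (b *ˢ c) d z n) (C.+-congʳ (P-* b c z n)))) (⟶-+ (⟶-* b p) q)

  P-cong-limit : ∀ c d z l → c ≋ d → P c z ⟶ l → P d z ⟶ l
  P-cong-limit c d z l p = ⟶-cong (P-cong z p)

  -- The relation gives ‖u‖ ≤ ‖u‖/2 + ‖z‖, and half of ‖u‖ is absorbed on the left; no estimate for
  -- 1/(z-1) enters.
  ‖u‖≤2‖z‖ : ∀ {z u} → u ≈ᶜ z *ᶜ u -ᶜ z → ‖ z ‖ ≤ h → ‖ u ‖ ≤ (1# + 1#) * ‖ z ‖
  ‖u‖≤2‖z‖ {z} {u} p z≤h = begin
    ‖ u ‖                         ≈⟨ halves ‖ u ‖ ⟨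
    h * ‖ u ‖ + h * ‖ u ‖         ≤⟨ +-mono-≤ hu≤z hu≤z ⟩
    ‖ z ‖ + ‖ z ‖                 ≈⟨ solve 1 (λ z → z :+ z := (con (+ 1) :+ con (+ 1)) :* z) refl _ ⟩
    (1# + 1#) * ‖ z ‖             ∎
    where
    hu≤z : h * ‖ u ‖ ≤ ‖ z ‖
    hu≤z = 0≤y-x⇒x≤y (≤-resp refl
      (solve 2 (λ a z → a :+ z :- (a :+ a) := z :- a) refl _ _)
      (x≤y⇒0≤y-x (≤-trans (inj₂ (halves ‖ u ‖)) (≤-trans (‖‖-cong≤ p)
        (≤-trans (‖‖-- _ _) (+-mono-≤ (≤-trans (‖‖-* _ _) (*-monoˡ-≤ (0≤‖‖ u) z≤h)) ≤-refl))))))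

  u≈zu-z : ∀ {z i} → (z -ᶜ C.1#) *ᶜ i ≈ᶜ C.1# → z *ᶜ i ≈ᶜ z *ᶜ (z *ᶜ i) -ᶜ z
  u≈zu-z {z} {i} p = C.trans
    (C-solve 2 (λ z i → z :*ᶜ i :=ᶜ z :*ᶜ (z :*ᶜ i) :-ᶜ z :*ᶜ ((z :-ᶜ conᶜ (+ 1)) :*ᶜ i)) C.refl z i)
    (C.+-congˡ (C.-‿cong (C.trans (C.*-congˡ p) (C.*-identityʳ z))))
    where open IntegerCoefficients C renaming (solve to C-solve; _:*_ to _:*ᶜ_; _:-_ to _:-ᶜ_; _:=_ to _:=ᶜ_; con to conᶜ)

-- Choice of the radius and the identity of the sums.

module Landen {c ℓ₁ ℓ₂} (ℝ : CompleteOrderedField c ℓ₁ ℓ₂) where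

  open Polylogarithms ℝ
  open ComplexField ℝ
  private
    module R = CompleteOrderedField ℝ
    module C = CommutativeRing ℂ-commutativeRing
  open OrderedField ℝ hiding (geometric-limit)
  open IntegerCoefficients R.commutativeRing
  open PartialSums ℂ-commutativeRing using (P)
  open PowerSeries ℝ ℂ-commutativeRing ℂ-norm
  open Bounds ℝ ℂ-commutativeRing ℂ-norm
  open Evaluation ℝ ℂ-commutativeRing fromℚ using (eval; evalWord)
  open WordSeries ℝ using (ρ; one; coeff-𝒜¹; T-φι)

  z-1≉0 : ∀ {z} → ‖ z ‖ ≤ h → ¬ (z - 1# ≈ 0#)
  z-1≉0 {z} z≤h (p , _) = <⇒≱ h<1 (≤-trans (0≤y-x⇒x≤y (inj₂ (R.sym p)))
    (≤-trans (x≤∣x∣ (re z)) (≤-trans (x≤x+y (0≤∣∣ (im z))) z≤h)))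

  -- The least K that `Geo-bound` admits for this letter. The norms of words and of polynomials are
  -- sums starting at 1, so that they dominate every letter and are at least 1.
  letterNorm : Letter → R.Carrier
  letterNorm x           = R.0#
  letterNorm (y (s , _)) = (R.1# R.+ R.1#) R.* ‖ s ‖

  wordNorm : Word → R.Carrier
  wordNorm = foldr (λ b k → letterNorm b R.+ k) R.1#

  𝒜Norm : 𝒜 → R.Carrier
  𝒜Norm = foldr (λ (_ , v) k → wordNorm v R.+ k) R.1#

  0≤letterNorm : ∀ b → R.0# ≤ letterNorm b
  0≤letterNorm x           = ≤-refl
  0≤letterNorm (y (s , _)) = 0≤* (inj₁ 0<2) (0≤‖‖ s)

  1≤wordNorm : ∀ v → R.1# ≤ wordNorm v
  1≤wordNorm []      = ≤-refl
  1≤wordNorm (b ∷ v) = ≤-trans (1≤wordNorm v) (y≤x+y (0≤letterNorm b))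

  1≤𝒜Norm : ∀ w → R.1# ≤ 𝒜Norm w
  1≤𝒜Norm []            = ≤-refl
  1≤𝒜Norm ((_ , v) ∷ w) = ≤-trans (1≤𝒜Norm w) (y≤x+y (≤-trans 0≤1 (1≤wordNorm v)))

  LettersBounded : R.Carrier → Word → Set _
  LettersBounded K = All (λ b → letterNorm b ≤ K)

  Bounded : R.Carrier → 𝒜 → Set _
  Bounded K = All (λ (_ , v) → LettersBounded K v)

  wordNorm-bounds : ∀ v → LettersBounded (wordNorm v) v
  wordNorm-bounds []      = []
  wordNorm-bounds (b ∷ v) = x≤x+y (≤-trans 0≤1 (1≤wordNorm v))
    ∷ All.map (λ p → ≤-trans p (y≤x+y (0≤letterNorm b))) (wordNorm-bounds v)

  𝒜Norm-bounds : ∀ w → Bounded (𝒜Norm w) w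
  𝒜Norm-bounds []            = []
  𝒜Norm-bounds ((_ , v) ∷ w) =
    All.map (λ p → ≤-trans p (x≤x+y (≤-trans 0≤1 (1≤𝒜Norm w)))) (wordNorm-bounds v)
    ∷ All.map (All.map (λ p → ≤-trans p (y≤x+y (≤-trans 0≤1 (1≤wordNorm v))))) (𝒜Norm-bounds w)

  Li-resp : ∀ {w z L L′} → L ≈ L′ → Li w at z ≔ L → Li w at z ≔ L′
  Li-resp {L = L} {L′} p (nil q)                = nil (C.trans {L′} {L} (C.sym {L} p) q)
  Li-resp {L = L} {L′} p (cons {q} {l = l} {l′ = l′} s t r) = cons s t (C.trans {L′} {L} {fromℚ q * l + l′} (C.sym {L} p) r)

  module _ {K : R.Carrier} (1≤K : R.1# ≤ K) where

    private
      0≤K : R.0# ≤ K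
      0≤K = ≤-trans 0≤1 1≤K

    word-bound : ∀ {v} → LettersBounded K v → GeometricBound R.1# K (evalWord ρ v one)
    word-bound []       zero    = ≤-trans ‖1‖≤1 (inj₂ (R.sym (R.*-identityˡ R.1#)))
    word-bound []       (suc n) = ≤-trans ‖0‖≤0 (0≤* 0≤1 (0≤^ (suc n) 0≤K))
    word-bound {x ∷ v}         (_ ∷ ps) = ∫-bound 0≤1 1≤K ×ₙ-inverse ‖inv‖≤1 (word-bound ps)
    word-bound {y (s , _) ∷ v} (p ∷ ps) = ∫-bound 0≤1 1≤K ×ₙ-inverse ‖inv‖≤1 (Geo-bound 0≤1 1≤K {s} p (word-bound ps))

    eval-bound : ∀ {w} → Bounded K w →
                 ∃[ A ] (R.0# ≤ A × GeometricBound A K (eval ρ w one))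
    eval-bound []                         = R.0# , ≤-refl , λ n → ≤-trans ‖0‖≤0 (inj₂ (R.sym (R.zeroˡ _)))
    eval-bound {(q , v) ∷ w} (p ∷ ps) = let B , 0≤B , b = eval-bound ps in
      ‖ fromℚ q ‖ R.* R.1# R.+ B ,
      ≤-trans 0≤B (y≤x+y (0≤* (0≤‖‖ (fromℚ q)) 0≤1)) ,
      combine-bounds {p = fromℚ q} {evalWord ρ v one} {eval ρ w one} (word-bound p) b

    -- `Li` sums each word separately, whereas the substitution compares the combined series of `w`
    -- and of φι(w), whose words do not correspond one to one. Hence the same L is produced for both
    -- descriptions.
    Li-exists : ∀ w z → w ∈𝒜¹ → Bounded K w → K R.* ‖ z ‖ ≤ h →
                ∃[ L ] (Li w at z ≔ L × P (eval ρ w one) z ⟶₁ L)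
    Li-exists [] z [] [] Kz≤h = 0# , nil (R.refl , R.refl) , P-0-limit z
    Li-exists ((q , v) ∷ w) z (p ∷ ps) (b ∷ bs) Kz≤h =
      add (series-converges {R.1#} {K} {evalWord ρ v one} {z} 0≤1 0≤K (word-bound b) Kz≤h) (Li-exists w z ps bs Kz≤h)
      where
      add : ∃[ l ] (P (evalWord ρ v one) z ⟶₁ l) → ∃[ l′ ] (Li w at z ≔ l′ × P (eval ρ w one) z ⟶₁ l′) →
            ∃[ L ] (Li (q , v) ∷ w at z ≔ L × P (eval ρ ((q , v) ∷ w) one) z ⟶₁ L)
      add (l , v⟶l) (l′ , Li-w , w⟶l′) = fromℚ q * l + l′ , cons (⟶₁⇒⟶ word) Li-w (R.refl , R.refl) ,
        P-combine-limit (fromℚ q) (evalWord ρ v one) (eval ρ w one) z l l′ v⟶l w⟶l′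
        where
        word : P (coeff (index v)) z ⟶₁ l
        word = P-cong-limit (evalWord ρ v one) (coeff (index v)) z l
                 (λ n → C.sym {coeff (index v) n} {evalWord ρ v one n} (coeff-𝒜¹ p n)) v⟶l

  landen : ∀ w → w ∈𝒜¹ → ∃[ ε ] (R.0# R.< ε × (∀ z → ∣ z ∣< ε →
            ∃[ L ] ((Li w at z ≔ L) × (Li φ (ι w) at (z / (z - 1#)) ≔ L))))
  landen w w∈𝒜¹ = ε , 0<ε , λ z ∣z∣<ε → at z (4Kz≤h z ∣z∣<ε)
    where
    -- One rate for both sides: w is summed at z, and φι(w) at u.
    K = 𝒜Norm (w ++ φ (ι w))

    1≤K : R.1# ≤ K
    1≤K = 1≤𝒜Norm (w ++ φ (ι w))

    0≤K : R.0# ≤ K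
    0≤K = ≤-trans 0≤1 1≤K

    w-bounded : Bounded K w
    w-bounded = All.++⁻ˡ w (𝒜Norm-bounds (w ++ φ (ι w)))

    w′-bounded : Bounded K (φ (ι w))
    w′-bounded = All.++⁻ʳ w (𝒜Norm-bounds (w ++ φ (ι w)))

    4K : R.Carrier
    4K = (R.1# R.+ R.1# R.+ (R.1# R.+ R.1#)) R.* K

    2K≤4K : K R.+ K ≤ 4K
    2K≤4K = ≤-trans (x≤x+y (≤-trans 0≤K (x≤x+y 0≤K)))
      (inj₂ (solve 1 (λ k → k :+ k :+ (k :+ k) := (con (+ 1) :+ con (+ 1) :+ (con (+ 1) :+ con (+ 1))) :* k) R.refl K))

    K≤4K : K ≤ 4K
    K≤4K = ≤-trans (x≤x+y 0≤K) 2K≤4K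

    1≤4K : R.1# ≤ 4K
    1≤4K = ≤-trans 1≤K K≤4K

    0<4K : R.0# R.< 4K
    0<4K = <-≤-trans R.0<1 1≤4K

    ε : R.Carrier
    -- The modulus below ε gives ℓ¹ norm below 2ε = h/(4K), that is, 4K‖z‖ < h.
    ε = h R.* (h R.* 4K R.⁻¹)

    0<ε : R.0# R.< ε
    0<ε = R.*-pos 0<h (R.*-pos 0<h (⁻¹-pos 0<4K))

    4Kz≤h : ∀ z → ∣ z ∣< ε → 4K R.* ‖ z ‖ ≤ h
    4Kz≤h z p = inj₁ (<-≤-trans (*-monoʳ-< 0<4K (∣∣<⇒‖‖< {z} 0<ε p)) (inj₂ (R.trans (R.*-congˡ (halves _))
      (R.trans (solve 3 (λ k h i → k :* (h :* i) := h :* (k :* i)) R.refl 4K h (4K R.⁻¹))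
      (R.trans (R.*-congˡ (*-inverse (>⇒≉ 0<4K))) (R.*-identityʳ h))))))

    module _ (z : ℂ) (4Kz≤h : 4K R.* ‖ z ‖ ≤ h) where

      z≤h : ‖ z ‖ ≤ h
      z≤h = ≤-trans (≤-resp (R.*-identityˡ ‖ z ‖) R.refl (*-monoˡ-≤ (0≤‖‖ z) 1≤4K)) 4Kz≤h

      Kz≤h : K R.* ‖ z ‖ ≤ h
      Kz≤h = ≤-trans (*-monoˡ-≤ (0≤‖‖ z) K≤4K) 4Kz≤h

      u : ℂ
      u = z / (z - 1#)

      u-eq : u ≈ z * u - z
      u-eq = u≈zu-z {z} {(z - 1#) ⁻¹} (ℂ-inverse (z - 1#) (z-1≉0 {z} z≤h))

      Ku≤h : K R.* ‖ u ‖ ≤ h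
      -- ‖u‖ ≤ 2‖z‖ costs a factor 2, which the 4 in 4K‖z‖ ≤ h also covers.
      Ku≤h = ≤-trans (*-monoʳ-≤ 0≤K (‖u‖≤2‖z‖ {z} {u} u-eq z≤h))
        (≤-trans (inj₂ (solve 2 (λ k z → k :* ((con (+ 1) :+ con (+ 1)) :* z) := (k :+ k) :* z) R.refl K ‖ z ‖))
        (≤-trans (*-monoˡ-≤ (0≤‖‖ z) 2K≤4K) 4Kz≤h))

      sums-agree : ∀ {L L′} → P (eval ρ w one) z ⟶₁ L → P (eval ρ (φ (ι w)) one) u ⟶₁ L′ → L′ ≈ L
      sums-agree {L} {L′} w⟶L w′⟶L′ = let A , 0≤A , bound = eval-bound 1≤K w′-bounded in
        -- The substituted series is that of φι(w), summed at u; by the formal identity `T` sends it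
        -- to the series of w, summed at z.
        Substitution.substitution-unique {z} {u} {K} u-eq 1≤K Ku≤h 4Kz≤h {A} (eval ρ (φ (ι w)) one) (eval ρ w one) L′ L
          0≤A bound (T-φι w∈𝒜¹) w′⟶L′ w⟶L

      at : ∃[ L ] ((Li w at z ≔ L) × (Li φ (ι w) at u ≔ L))
      at = combine (Li-exists 1≤K w z w∈𝒜¹ w-bounded Kz≤h)
                   (Li-exists 1≤K (φ (ι w)) u (φ-𝒜¹ (ι-𝒜¹ w∈𝒜¹)) w′-bounded Ku≤h)
        where
        combine : ∃[ L ] (Li w at z ≔ L × P (eval ρ w one) z ⟶₁ L) →
                  ∃[ L ] (Li φ (ι w) at u ≔ L × P (eval ρ (φ (ι w)) one) u ⟶₁ L) →
                  ∃[ L ] ((Li w at z ≔ L) × (Li φ (ι w) at u ≔ L))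
        combine (L , Li-w , w⟶L) (L′ , Li-w′ , w′⟶L′) =
          L , Li-w , Li-resp {φ (ι w)} {u} {L′} {L} (sums-agree w⟶L w′⟶L′) Li-w′

theorem2p2 :
  ∀ {c ℓ₁ ℓ₂} (ℝ : CompleteOrderedField c ℓ₁ ℓ₂) →
  let open Polylogarithms ℝ
      module R = CompleteOrderedField ℝ
  in ∀ (w : 𝒜) → w ∈𝒜¹ →
     ∃[ ε ] (R.0# R.< ε × (∀ (z : ℂ) → ∣ z ∣< ε →
       ∃[ L ] ((Li w at z ≔ L) × (Li φ (ι w) at (z / (z - 1#)) ≔ L))))
theorem2p2 ℝ = Landen.landen ℝ
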